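{- Let $K\ge2$ and $T\ge0$ be integers, $0<p<1/2$, and let $X_1<X_2<\dots<X_K$ be given real numbers. In the adaptive sampling setting for computing $\mathsf{SEARCH}$ from noisy pairwise comparisons, $$\inf_{\hat\mu}\ \sup_{X}\ \mathbb{P}\big(\hat\mu\ne\mathsf{SEARCH}(X)\big)\ \ge\ \frac14\max\left(\exp\big(-T\cdot D_{\mathsf{KL}}(p\|1-p)\big),\ 1-\frac{T\cdot(1-H(p))}{\log(K)}\right),$$ where the supremum is over real $X\notin\{X_1,\dots,X_K\}$ and the infimum is over all adaptive algorithms making $T$ queries. Consequently, the number of queries required to recover the true value with probability at least $1-\delta$ is $\Omega\left(\frac{\log(K)}{1-H(p)}+\frac{\log(1/\delta)}{D_{\mathsf{KL}}(p\|1-p)}\right)$; that is, there is a universal constant $c>0$ such that for all $K\ge2$, $p\in(0,1/2)$ and $\delta\in(0,0.49)$, any adaptive algorithm making $T$ queries with $\sup_X\mathbb{P}(\hat\mu\ne\mathsf{SEARCH}(X))\le\delta$ satisfies $$T\ \ge\ c\left(\frac{\log(K)}{1-H(p)}+\frac{\log(1/\delta)}{D_{\mathsf{KL}}(p\|1-p)}\right).$$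
   Context: With the convention $X_0=-\infty$, $X_{K+1}=+\infty$, for real $X\notin\{X_1,\dots,X_K\}$ define $\mathsf{SEARCH}(X)=\mathsf{SEARCH}(X;X_1,\dots,X_K)=i$, where $i\in\{0,1,\dots,K\}$ is the index with $X_i<X<X_{i+1}$. The sorted order of $X_1,\dots,X_K$ is known; the position of $X$ is unknown. One query consists of choosing $i\in\{1,\dots,K\}$ and observing a noisy comparison of $X$ with $X_i$: a Bernoulli$(1-p)$ sample if $X>X_i$ and a Bernoulli$(p)$ sample if $X<X_i$, with noise independent across queries. An adaptive algorithm $\hat\mu$ with $T$ queries chooses the index queried in each of the $T$ rounds, possibly at random, as a function of all past queries and observations, and after $T$ rounds outputs a (possibly random) value in $\{0,1,\dots,K\}$, also denoted $\hat\mu$; $p$ is known. $\mathbb{P}$ is over the observation noise and the algorithm's randomness when the truth is $X$. Notation: $\log$ is natural; $H(p)=-p\log_2 p-(1-p)\log_2(1-p)$ is the binary entropy in bits; $D_{\mathsf{KL}}(p\|1-p)=(1-2p)\log\frac{1-p}{p}$ is the Kullback–Leibler divergence (in nats) between Bernoulli$(p)$ and Bernoulli$(1-p)$. -}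

module Defs where

open import Level using (0ℓ)
open import Algebra.Bundles using (CommutativeRing)
import Algebra.Construct.NaturalChoice.Max as NaturalMax
import Algebra.Properties.Ring as RingProperties
import Algebra.Properties.Semiring.Exp as SemiringExp
import Algebra.Properties.Semiring.Mult as SemiringMult
import Algebra.Properties.Semiring.Sum as SemiringSum
open import Axiom.ExcludedMiddle using (ExcludedMiddle)
open import Data.Bool.Base using (Bool; true; false; if_then_else_)
open import Data.Empty using (⊥-elim)
open import Data.Fin.Base using (Fin; zero; suc; inject₁)
import Data.Fin.Properties as Fin
open import Data.Nat.Base as ℕ using (ℕ; zero; suc; _!)
import Data.Nat.Properties as ℕ
open import Data.Product.Base using (∃; _×_; _,_; proj₁; proj₂)
open import Data.Sum.Base using (_⊎_; inj₁; inj₂)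
open import Data.Vec.Base using (Vec; []; _∷_; _∷ʳ_; map; lookup)
import Data.Vec.Membership.Setoid as VecMembership
open import Data.Vec.Relation.Unary.Any using (here; there)
open import Data.Vec.Relation.Unary.Linked using (Linked)
open import Relation.Binary.Bundles using (StrictPartialOrder; TotalOrder)
open import Relation.Binary.Core using (Rel)
open import Relation.Binary.Definitions using (tri<; tri≈; tri>)
open import Relation.Binary.Structures using (IsStrictTotalOrder; IsTotalOrder)
import Relation.Binary.Construct.Add.Extrema.Strict as StrictExtrema
import Relation.Binary.Construct.StrictToNonStrict as ToNonStrict
import Relation.Binary.Reasoning.StrictPartialOrder as StrictReasoning
import Relation.Binary.PropositionalEquality.Core as ≡
open import Relation.Nullary.Construct.Add.Extrema using (_±; ⊥±; ⊤±; [_])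
open import Relation.Nullary.Decidable.Core using (yes; no; does)
open import Relation.Nullary.Negation.Core using (¬_; contradiction)
open import Relation.Unary using (Pred)

module Bounds {A : Set} (_≤_ : Rel A 0ℓ) where

  UpperBound : Pred A 0ℓ → Pred A 0ℓ
  UpperBound S u = ∀ {x} → S x → x ≤ u

  LowerBound : Pred A 0ℓ → Pred A 0ℓ
  LowerBound S l = ∀ {x} → S x → l ≤ x

  IsSupremum : Pred A 0ℓ → Pred A 0ℓ
  IsSupremum S s = UpperBound S s × (∀ {u} → UpperBound S u → s ≤ u)

  IsInfimum : Pred A 0ℓ → Pred A 0ℓ
  IsInfimum S s = LowerBound S s × (∀ {l} → LowerBound S l → l ≤ s)

-- The standard library has no real numbers.  They enter through their
-- usual axioms, which determine them up to isomorphism: a model is an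
-- ordered field in which every nonempty bounded-above set has a least
-- upper bound.  Order and equality are decidable, as they are classically.
record CompleteOrderedField : Set₁ where
  infix 4 _<_
  field
    commutativeRing : CommutativeRing 0ℓ 0ℓ

  open CommutativeRing commutativeRing public

  field
    _<_                : Rel Carrier 0ℓ
    isStrictTotalOrder : IsStrictTotalOrder _≈_ _<_

  open ToNonStrict _≈_ _<_ public using (_≤_)

  open Bounds _≤_ public

  field
    0≉1      : ¬ 0# ≈ 1#
    inverse  : ∀ x → ¬ x ≈ 0# → ∃ λ y → x * y ≈ 1#
    +-monoʳ-< : ∀ x {y z} → y < z → x + y < x + z
    *-pos    : ∀ {x y} → 0# < x → 0# < y → 0# < x * y
    complete : (S : Pred Carrier 0ℓ) → ∃ S → ∃ (UpperBound S) → ∃ (IsSupremum S)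

-- Excluded middle is assumed because the mathematics is classical; it also
-- makes the axioms above satisfiable.
module Reals (em : ExcludedMiddle 0ℓ) (R : CompleteOrderedField) where

  open CompleteOrderedField R public
    renaming (Carrier to ℝ; refl to ≈-refl; sym to ≈-sym; trans to ≈-trans;
              zero to *-zero)
  open SemiringExp semiring public using (_^_)
  open SemiringMult semiring public using (×-homo-+; ×1-homo-*)
    renaming (_×_ to _·_)
  open SemiringSum semiring public using (sum; sum-cong-≋; *-distribˡ-sum;
    *-distribʳ-sum; ∑-comm; ∑-distrib-+)
  open RingProperties ring public
    using (-‿distribʳ-*; -‿distribˡ-*; -‿involutive; -0#≈0#)

  strictPartialOrder : StrictPartialOrder 0ℓ 0ℓ 0ℓ
  strictPartialOrder = record
    { isStrictPartialOrder =
        IsStrictTotalOrder.isStrictPartialOrder isStrictTotalOrder }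

  open StrictPartialOrder strictPartialOrder public
    using (<-respˡ-≈; <-respʳ-≈)
    renaming (trans to <-trans; irrefl to <-irrefl; asym to <-asym)
  open IsStrictTotalOrder isStrictTotalOrder public using (compare; _≟_; _<?_)

  totalOrder : TotalOrder 0ℓ 0ℓ 0ℓ
  totalOrder = record
    { isTotalOrder = ToNonStrict.isTotalOrder _≈_ _<_ isStrictTotalOrder }

  open TotalOrder totalOrder public using ()
    renaming (total to ≤-total; trans to ≤-trans; refl to ≤-refl;
              reflexive to ≤-reflexive; antisym to ≤-antisym)
  open NaturalMax totalOrder public using (_⊔_)

  open StrictReasoning strictPartialOrder

  infix  9 _⁻¹
  infixl 7 _/_

  fromℕ : ℕ → ℝ
  fromℕ n = n · 1#

  -- Total; 0# ⁻¹ is 0# by convention.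
  _⁻¹ : ℝ → ℝ
  x ⁻¹ with x ≟ 0#
  ... | yes _   = 0#
  ... | no  x≉0 = proj₁ (inverse x x≉0)

  _/_ : ℝ → ℝ → ℝ
  x / y = x * y ⁻¹

  ½ : ℝ
  ½ = 1# / fromℕ 2

  <⇒≤ : ∀ {x y} → x < y → x ≤ y
  <⇒≤ = inj₁

  <⇒≱ : ∀ {x y} → x < y → ¬ y ≤ x
  <⇒≱ x<y (inj₁ y<x) = <-asym x<y y<x
  <⇒≱ x<y (inj₂ y≈x) = <-irrefl (≈-sym y≈x) x<y

  ≮⇒≥ : ∀ {x y} → ¬ x < y → y ≤ x
  ≮⇒≥ {x} {y} x≮y with compare x y
  ... | tri< x<y _   _   = contradiction x<y x≮y
  ... | tri≈ _   x≈y _   = inj₂ (≈-sym x≈y)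
  ... | tri> _   _   y<x = inj₁ y<x

  +-monoˡ-< : ∀ x {y z} → y < z → y + x < z + x
  +-monoˡ-< x {y} {z} y<z = begin-strict
    y + x ≈⟨ +-comm y x ⟩
    x + y <⟨ +-monoʳ-< x y<z ⟩
    x + z ≈⟨ +-comm x z ⟩
    z + x ∎

  +-monoʳ-≤ : ∀ x {y z} → y ≤ z → x + y ≤ x + z
  +-monoʳ-≤ x (inj₁ y<z) = inj₁ (+-monoʳ-< x y<z)
  +-monoʳ-≤ x (inj₂ y≈z) = inj₂ (+-congˡ y≈z)

  +-mono-≤ : ∀ {w x y z} → w ≤ x → y ≤ z → w + y ≤ x + z
  +-mono-≤ {w} {x} {y} {z} w≤x y≤z = begin
    w + y ≤⟨ +-monoʳ-≤ w y≤z ⟩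
    w + z ≈⟨ +-comm w z ⟩
    z + w ≤⟨ +-monoʳ-≤ z w≤x ⟩
    z + x ≈⟨ +-comm z x ⟩
    x + z ∎

  x-y+y≈x : ∀ x y → (x - y) + y ≈ x
  x-y+y≈x x y = begin-equality
    (x - y) + y   ≈⟨ +-assoc x (- y) y ⟩
    x + (- y + y) ≈⟨ +-congˡ (-‿inverseˡ y) ⟩
    x + 0#        ≈⟨ +-identityʳ x ⟩
    x             ∎

  x<y⇒0<y-x : ∀ {x y} → x < y → 0# < y - x
  x<y⇒0<y-x {x} {y} x<y = begin-strict
    0#    ≈⟨ -‿inverseʳ x ⟨
    x - x <⟨ +-monoˡ-< (- x) x<y ⟩
    y - x ∎

  0<y-x⇒x<y : ∀ {x y} → 0# < y - x → x < y
  0<y-x⇒x<y {x} {y} 0<y-x = begin-strict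
    x           ≈⟨ +-identityˡ x ⟨
    0# + x      <⟨ +-monoˡ-< x 0<y-x ⟩
    (y - x) + x ≈⟨ x-y+y≈x y x ⟩
    y           ∎

  x≤0⇒0≤-x : ∀ {x} → x ≤ 0# → 0# ≤ - x
  x≤0⇒0≤-x {x} x≤0 = begin
    0#       ≈⟨ -‿inverseˡ x ⟨
    - x + x  ≤⟨ +-monoʳ-≤ (- x) x≤0 ⟩
    - x + 0# ≈⟨ +-identityʳ (- x) ⟩
    - x      ∎

  0<x⇒-x<0 : ∀ {x} → 0# < x → - x < 0#
  0<x⇒-x<0 {x} 0<x = begin-strict
    - x      ≈⟨ +-identityʳ (- x) ⟨
    - x + 0# <⟨ +-monoʳ-< (- x) 0<x ⟩
    - x + x  ≈⟨ -‿inverseˡ x ⟩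
    0#       ∎

  *-monoˡ-< : ∀ {x y z} → 0# < x → y < z → x * y < x * z
  *-monoˡ-< {x} {y} {z} 0<x y<z = 0<y-x⇒x<y (begin-strict
    0#              <⟨ *-pos 0<x (x<y⇒0<y-x y<z) ⟩
    x * (z - y)     ≈⟨ distribˡ x z (- y) ⟩
    x * z + x * - y ≈⟨ +-congˡ (-‿distribʳ-* x y) ⟨
    x * z - x * y   ∎)

  *-monoˡ-≤ : ∀ {x y z} → 0# ≤ x → y ≤ z → x * y ≤ x * z
  *-monoˡ-≤ (inj₁ 0<x) (inj₁ y<z) = inj₁ (*-monoˡ-< 0<x y<z)
  *-monoˡ-≤ {x} {y} {z} (inj₂ 0≈x) _ = inj₂ (begin-equality
    x * y  ≈⟨ *-congʳ 0≈x ⟨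
    0# * y ≈⟨ zeroˡ y ⟩
    0#     ≈⟨ zeroˡ z ⟨
    0# * z ≈⟨ *-congʳ 0≈x ⟩
    x * z  ∎)
  *-monoˡ-≤ _ (inj₂ y≈z) = inj₂ (*-congˡ y≈z)

  0≤x*y : ∀ {x y} → 0# ≤ x → 0# ≤ y → 0# ≤ x * y
  0≤x*y {x} {y} 0≤x 0≤y = begin
    0#     ≈⟨ zeroʳ x ⟨
    x * 0# ≤⟨ *-monoˡ-≤ 0≤x 0≤y ⟩
    x * y  ∎

  0≤x+y : ∀ {x y} → 0# ≤ x → 0# ≤ y → 0# ≤ x + y
  0≤x+y {x} {y} 0≤x 0≤y = begin
    0#      ≈⟨ +-identityˡ 0# ⟨
    0# + 0# ≤⟨ +-mono-≤ 0≤x 0≤y ⟩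
    x + y   ∎

  0<1 : 0# < 1#
  0<1 with compare 0# 1#
  ... | tri< 0<1 _   _   = 0<1
  ... | tri≈ _   0≈1 _   = contradiction 0≈1 0≉1
  ... | tri> _   _   1<0 = begin-strict
    0#            <⟨ *-pos 0<-1 0<-1 ⟩
    - 1# * - 1#   ≈⟨ -‿distribˡ-* 1# (- 1#) ⟨
    - (1# * - 1#) ≈⟨ -‿cong (*-identityˡ (- 1#)) ⟩
    - - 1#        ≈⟨ -‿involutive 1# ⟩
    1#            ∎
    where
    0<-1 : 0# < - 1#
    0<-1 = begin-strict
      0#       <⟨ x<y⇒0<y-x 1<0 ⟩
      0# - 1#  ≈⟨ +-identityˡ (- 1#) ⟩
      - 1#     ∎

  0≤fromℕ : ∀ n → 0# ≤ fromℕ n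
  0≤fromℕ zero    = ≤-refl
  0≤fromℕ (suc n) = 0≤x+y (<⇒≤ 0<1) (0≤fromℕ n)

  0<fromℕ : ∀ n → .{{ℕ.NonZero n}} → 0# < fromℕ n
  0<fromℕ (suc n) = begin-strict
    0#           <⟨ 0<1 ⟩
    1#           ≈⟨ +-identityʳ 1# ⟨
    1# + 0#      ≤⟨ +-monoʳ-≤ 1# (0≤fromℕ n) ⟩
    1# + fromℕ n ∎

  fromℕ-mono-≤ : ∀ {m n} → m ℕ.≤ n → fromℕ m ≤ fromℕ n
  fromℕ-mono-≤ {n = n} ℕ.z≤n = 0≤fromℕ n
  fromℕ-mono-≤ (ℕ.s≤s m≤n) = +-monoʳ-≤ 1# (fromℕ-mono-≤ m≤n)

  x*x⁻¹≈1 : ∀ {x} → 0# < x → x * x ⁻¹ ≈ 1#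
  x*x⁻¹≈1 {x} 0<x with x ≟ 0#
  ... | yes x≈0 = contradiction 0<x (<-irrefl (≈-sym x≈0))
  ... | no  x≉0 = proj₂ (inverse x x≉0)

  x⁻¹>0 : ∀ {x} → 0# < x → 0# < x ⁻¹
  x⁻¹>0 {x} 0<x with compare 0# (x ⁻¹)
  ... | tri< 0<y _   _   = 0<y
  ... | tri≈ _   0≈y _   = contradiction (begin-equality
    0#       ≈⟨ zeroʳ x ⟨
    x * 0#   ≈⟨ *-congˡ 0≈y ⟩
    x * x ⁻¹ ≈⟨ x*x⁻¹≈1 0<x ⟩
    1#       ∎) 0≉1
  ... | tri> _   _   y<0 = contradiction 0<1 (<-asym (begin-strict
    1#       ≈⟨ x*x⁻¹≈1 0<x ⟨
    x * x ⁻¹ <⟨ *-monoˡ-< 0<x y<0 ⟩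
    x * 0#   ≈⟨ zeroʳ x ⟩
    0#       ∎))

  infimum : (S : Pred ℝ 0ℓ) → ∃ S → ∃ (LowerBound S) → ∃ (IsInfimum S)
  infimum S (x , Sx) (l , l-lower) =
    let s , s-upper , s-least = complete (LowerBound S) (l , l-lower) (x , λ b → b Sx)
    in  s , (λ Sy → s-least (λ b → b Sy)) , s-upper

  archimedean : ∀ x → ∃ λ n → x ≤ fromℕ n
  archimedean x with em {∃ λ n → x ≤ fromℕ n}
  ... | yes found = found
  ... | no  none  = ⊥-elim (<⇒≱ s-1<s (s-least s-1-upper))
    where
    Naturals : Pred ℝ 0ℓ
    Naturals y = ∃ λ n → y ≈ fromℕ n

    x-upper : UpperBound Naturals x
    x-upper {y} (n , y≈n) = ≮⇒≥ λ x<y → none (n , <⇒≤ (<-respʳ-≈ y≈n x<y))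

    lub = complete Naturals (0# , 0 , ≈-refl) (x , x-upper)
    s = proj₁ lub
    s-upper = proj₁ (proj₂ lub)
    s-least = proj₂ (proj₂ lub)

    s-1<s : s - 1# < s
    s-1<s = begin-strict
      s - 1# <⟨ +-monoʳ-< s (0<x⇒-x<0 0<1) ⟩
      s + 0# ≈⟨ +-identityʳ s ⟩
      s      ∎

    s-1-upper : UpperBound Naturals (s - 1#)
    s-1-upper {y} (n , y≈n) = begin
      y              ≈⟨ +-identityʳ y ⟨
      y + 0#         ≈⟨ +-congˡ (-‿inverseʳ 1#) ⟨
      y + (1# - 1#)  ≈⟨ +-assoc y 1# (- 1#) ⟨
      (y + 1#) - 1#  ≈⟨ +-comm (y + 1#) (- 1#) ⟩
      - 1# + (y + 1#) ≤⟨ +-monoʳ-≤ (- 1#)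
                          (s-upper (suc n , ≈-trans (+-comm y 1#) (+-congˡ y≈n))) ⟩
      - 1# + s       ≈⟨ +-comm (- 1#) s ⟩
      s - 1#         ∎

  expTerm : ℝ → ℕ → ℝ
  expTerm x n = x ^ n / fromℕ (n !)

  -- ∑_{k<n} xᵏ / k!
  expSum : ℝ → ℕ → ℝ
  expSum x zero    = 0#
  expSum x (suc n) = expSum x n + expTerm x n

  ExpSums : ℝ → Pred ℝ 0ℓ
  ExpSums x y = ∃ λ n → y ≈ expSum x n

  0<n! : ∀ n → 0# < fromℕ (n !)
  0<n! n = 0<fromℕ (n !) {{ℕ._!≢0 n}}

  expTerm-step : ∀ x n → fromℕ (suc n) * expTerm x (suc n) ≈ x * expTerm x n
  expTerm-step x n = begin-equality
    c * ((x * a) * F)             ≈⟨ *-identityʳ _ ⟨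
    c * ((x * a) * F) * 1#        ≈⟨ *-congˡ (x*x⁻¹≈1 (0<n! n)) ⟨
    c * ((x * a) * F) * (f * g)   ≈⟨ *-assoc _ f g ⟨
    c * ((x * a) * F) * f * g     ≈⟨ *-congʳ (*-comm _ f) ⟩
    f * (c * ((x * a) * F)) * g   ≈⟨ *-congʳ (*-assoc f c _) ⟨
    f * c * ((x * a) * F) * g     ≈⟨ *-congʳ (*-congʳ (*-comm f c)) ⟩
    c * f * ((x * a) * F) * g     ≈⟨ *-congʳ (*-congˡ (*-comm _ F)) ⟩
    c * f * (F * (x * a)) * g     ≈⟨ *-congʳ (*-assoc (c * f) F _) ⟨
    (c * f) * F * (x * a) * g     ≈⟨ *-congʳ (*-congʳ (*-congʳ (×1-homo-* (suc n) (n !)))) ⟨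
    fromℕ (suc n !) * F * (x * a) * g ≈⟨ *-congʳ (*-congʳ (x*x⁻¹≈1 (0<n! (suc n)))) ⟩
    1# * (x * a) * g              ≈⟨ *-congʳ (*-identityˡ _) ⟩
    x * a * g                     ≈⟨ *-assoc x a g ⟩
    x * (a * g)                   ∎
    where
    c = fromℕ (suc n)
    a = x ^ n
    f = fromℕ (n !)
    g = f ⁻¹
    F = fromℕ (suc n !) ⁻¹

  0≤x^n : ∀ {x} → 0# ≤ x → ∀ n → 0# ≤ x ^ n
  0≤x^n 0≤x zero    = <⇒≤ 0<1
  0≤x^n 0≤x (suc n) = 0≤x*y 0≤x (0≤x^n 0≤x n)

  0≤expTerm : ∀ {x} → 0# ≤ x → ∀ n → 0# ≤ expTerm x n
  0≤expTerm 0≤x n = 0≤x*y (0≤x^n 0≤x n) (<⇒≤ (x⁻¹>0 (0<n! n)))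

  expTerm-halves : ∀ {x} → 0# ≤ x → ∀ n → x + x ≤ fromℕ (suc n) →
                   expTerm x (suc n) + expTerm x (suc n) ≤ expTerm x n
  expTerm-halves {x} 0≤x n 2x≤n+1 = ≮⇒≥ λ t<2t′ → <-irrefl ≈-refl (begin-strict
    c * t           <⟨ *-monoˡ-< (0<fromℕ (suc n)) t<2t′ ⟩
    c * (t′ + t′)   ≈⟨ distribˡ c t′ t′ ⟩
    c * t′ + c * t′ ≈⟨ +-cong (expTerm-step x n) (expTerm-step x n) ⟩
    x * t + x * t   ≈⟨ distribʳ t x x ⟨
    (x + x) * t     ≈⟨ *-comm (x + x) t ⟩
    t * (x + x)     ≤⟨ *-monoˡ-≤ (0≤expTerm 0≤x n) 2x≤n+1 ⟩
    t * c           ≈⟨ *-comm t c ⟩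
    c * t           ∎)
    where
    c  = fromℕ (suc n)
    t  = expTerm x n
    t′ = expTerm x (suc n)

  expSums-bounded : ∀ {x} → 0# ≤ x → ∃ (UpperBound (ExpSums x))
  expSums-bounded {x} 0≤x = U N , λ { {y} (n , y≈Sₙ) → begin
    y                  ≈⟨ y≈Sₙ ⟩
    expSum x n         ≤⟨ mono n ⟩
    expSum x (n ℕ.+ N) ≈⟨ +-identityʳ _ ⟨
    expSum x (n ℕ.+ N) + 0# ≤⟨ +-monoʳ-≤ _ (0≤x+y (0≤t (n ℕ.+ N)) (0≤t (n ℕ.+ N))) ⟩
    U (n ℕ.+ N)        ≤⟨ descends n ⟩
    U N                ∎ }
    where
    N = proj₁ (archimedean (x + x))
    2x≤N = proj₂ (archimedean (x + x))
    t = expTerm x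
    0≤t = 0≤expTerm 0≤x

    U : ℕ → ℝ
    U n = expSum x n + (t n + t n)

    descend : ∀ n → N ℕ.≤ n → U (suc n) ≤ U n
    descend n N≤n = begin
      (expSum x n + t n) + (t (suc n) + t (suc n)) ≤⟨ +-monoʳ-≤ _ (expTerm-halves 0≤x n
          (≤-trans 2x≤N (fromℕ-mono-≤ (ℕ.m≤n⇒m≤1+n N≤n)))) ⟩
      (expSum x n + t n) + t n                     ≈⟨ +-assoc _ (t n) (t n) ⟩
      U n                                          ∎

    descends : ∀ n → U (n ℕ.+ N) ≤ U N
    descends zero    = ≤-refl
    descends (suc n) = ≤-trans (descend (n ℕ.+ N) (ℕ.m≤n+m N n)) (descends n)

    step : ∀ m → expSum x m ≤ expSum x (suc m)
    step m = begin
      expSum x m       ≈⟨ +-identityʳ _ ⟨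
      expSum x m + 0#  ≤⟨ +-monoʳ-≤ _ (0≤t m) ⟩
      expSum x m + t m ∎

    mono′ : ∀ k n → expSum x n ≤ expSum x (k ℕ.+ n)
    mono′ zero    n = ≤-refl
    mono′ (suc k) n = ≤-trans (mono′ k n) (step (k ℕ.+ n))

    mono : ∀ n → expSum x n ≤ expSum x (n ℕ.+ N)
    mono n = ≡.subst (λ m → expSum x n ≤ expSum x m) (ℕ.+-comm N n) (mono′ N n)

  -- For x ≥ 0 the partial sums of the exponential series increase, so
  -- their limit is their supremum.
  expNonneg-spec : ∀ x → 0# ≤ x → ∃ (IsSupremum (ExpSums x))
  expNonneg-spec x 0≤x = complete (ExpSums x) (0# , 0 , ≈-refl) (expSums-bounded 0≤x)

  expNonneg : ∀ x → 0# ≤ x → ℝ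
  expNonneg x 0≤x = proj₁ (expNonneg-spec x 0≤x)

  exp : ℝ → ℝ
  exp x with ≤-total 0# x
  ... | inj₁ 0≤x = expNonneg x 0≤x
  ... | inj₂ x≤0 = expNonneg (- x) (x≤0⇒0≤-x x≤0) ⁻¹

  1+x≤expNonneg : ∀ x (0≤x : 0# ≤ x) → 1# + x ≤ expNonneg x 0≤x
  1+x≤expNonneg x 0≤x = begin
    1# + x     ≈⟨ +-cong (unit 1#) (unit x) ⟨
    1# / fromℕ 1 + x / fromℕ 1 ≈⟨ +-cong (≈-sym (+-identityˡ _)) (*-congʳ (≈-sym (*-identityʳ x))) ⟩
    expSum x 2 ≤⟨ proj₁ (proj₂ (expNonneg-spec x 0≤x)) (2 , ≈-refl) ⟩
    expNonneg x 0≤x ∎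
    where
    unit : ∀ y → y / fromℕ 1 ≈ y
    unit y = begin-equality
      y / fromℕ 1                ≈⟨ *-congˡ (*-identityˡ _) ⟨
      y * (1# * fromℕ 1 ⁻¹)      ≈⟨ *-congˡ (*-congʳ (+-identityʳ 1#)) ⟨
      y * (fromℕ 1 * fromℕ 1 ⁻¹) ≈⟨ *-congˡ (x*x⁻¹≈1 (0<fromℕ 1)) ⟩
      y * 1#                     ≈⟨ *-identityʳ y ⟩
      y                          ∎

  x<expNonneg : ∀ x (0≤x : 0# ≤ x) → x < expNonneg x 0≤x
  x<expNonneg x 0≤x = begin-strict
    x      ≈⟨ +-identityˡ x ⟨
    0# + x <⟨ +-monoˡ-< x 0<1 ⟩
    1# + x ≤⟨ 1+x≤expNonneg x 0≤x ⟩
    expNonneg x 0≤x ∎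

  ExpBelow : ℝ → Pred ℝ 0ℓ
  ExpBelow y x = exp x ≤ y

  expBelow-nonempty : ∀ {y} → 0# < y → ∃ (ExpBelow y)
  expBelow-nonempty {y} 0<y = - y ⁻¹ , below
    where
    0<y⁻¹ = x⁻¹>0 0<y

    below : exp (- y ⁻¹) ≤ y
    below with ≤-total 0# (- y ⁻¹)
    ... | inj₁ 0≤-y⁻¹ = ⊥-elim (<⇒≱ (0<x⇒-x<0 0<y⁻¹) 0≤-y⁻¹)
    ... | inj₂ -y⁻¹≤0 = begin
      E ⁻¹              ≈⟨ *-identityʳ _ ⟨
      E ⁻¹ * 1#         ≈⟨ *-congˡ (x*x⁻¹≈1 0<y) ⟨
      E ⁻¹ * (y * y ⁻¹) ≤⟨ *-monoˡ-≤ (<⇒≤ (x⁻¹>0 0<E)) (*-monoˡ-≤ (<⇒≤ 0<y) (<⇒≤ y⁻¹<E)) ⟩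
      E ⁻¹ * (y * E)    ≈⟨ *-comm _ _ ⟩
      y * E * E ⁻¹      ≈⟨ *-assoc y E _ ⟩
      y * (E * E ⁻¹)    ≈⟨ *-congˡ (x*x⁻¹≈1 0<E) ⟩
      y * 1#            ≈⟨ *-identityʳ y ⟩
      y                 ∎
      where
      0≤z = x≤0⇒0≤-x -y⁻¹≤0
      E = expNonneg (- - y ⁻¹) 0≤z

      y⁻¹<E : y ⁻¹ < E
      y⁻¹<E = <-respˡ-≈ (-‿involutive (y ⁻¹)) (x<expNonneg (- - y ⁻¹) 0≤z)

      0<E : 0# < E
      0<E = <-trans 0<y⁻¹ y⁻¹<E

  expBelow-bounded : ∀ {y} → 0# < y → ∃ (UpperBound (ExpBelow y))
  expBelow-bounded {y} 0<y = y , λ {x} → bound x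
    where
    bound : ∀ x → exp x ≤ y → x ≤ y
    bound x eˣ≤y with ≤-total 0# x
    ... | inj₁ 0≤x = ≤-trans (<⇒≤ (x<expNonneg x 0≤x)) eˣ≤y
    ... | inj₂ x≤0 = ≤-trans x≤0 (<⇒≤ 0<y)

  log-spec : ∀ y → 0# < y → ∃ (IsSupremum (ExpBelow y))
  log-spec y 0<y = complete (ExpBelow y) (expBelow-nonempty 0<y) (expBelow-bounded 0<y)

  -- Natural logarithm, as the supremum of the x with exp x ≤ y; log y is 0# for y ≤ 0# by convention.
  log : ℝ → ℝ
  log y with 0# <? y
  ... | yes 0<y = proj₁ (log-spec y 0<y)
  ... | no  _   = 0#

  log₂ : ℝ → ℝ
  log₂ y = log y / log (fromℕ 2)

  H : ℝ → ℝ
  H p = - (p * log₂ p) - (1# - p) * log₂ (1# - p)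

  -- The divergence D_KL(p ‖ 1 − p) between Bernoulli(p) and Bernoulli(1 − p).
  D-KL[_‖1-] : ℝ → ℝ
  D-KL[ p ‖1-] = (1# - fromℕ 2 * p) * log ((1# - p) / p)

  record Distribution (n : ℕ) : Set where
    field
      weight     : Fin n → ℝ
      nonneg     : ∀ i → 0# ≤ weight i
      normalised : sum weight ≈ 1#

  open Distribution public

  uniform : ∀ n → .{{ℕ.NonZero n}} → Distribution n
  uniform n .weight _   = fromℕ n ⁻¹
  uniform n .nonneg _   = <⇒≤ (x⁻¹>0 (0<fromℕ n))
  uniform n .normalised = begin-equality
    sum {n} (λ _ → fromℕ n ⁻¹)       ≈⟨ sum-cong-≋ {n} (λ _ → *-identityʳ (fromℕ n ⁻¹)) ⟨
    sum {n} (λ _ → fromℕ n ⁻¹ * 1#)  ≈⟨ *-distribˡ-sum {n} (fromℕ n ⁻¹) (λ _ → 1#) ⟨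
    fromℕ n ⁻¹ * sum {n} (λ _ → 1#)  ≈⟨ *-congˡ (ones n) ⟩
    fromℕ n ⁻¹ * fromℕ n             ≈⟨ *-comm _ _ ⟩
    fromℕ n * fromℕ n ⁻¹             ≈⟨ x*x⁻¹≈1 (0<fromℕ n) ⟩
    1#                               ∎
    where
    ones : ∀ m → sum {m} (λ _ → 1#) ≈ fromℕ m
    ones zero    = ≈-refl
    ones (suc m) = +-congˡ (ones m)

  -- The subtree entered is determined by the past queries and answers, so
  -- the node reached after t rounds is a function of that history.  Its
  -- distribution is the conditional law, given the history, of the next
  -- query or of the output; this covers arbitrary internal randomness.
  data Algorithm (K : ℕ) : ℕ → Set where
    output : Distribution (suc K) → Algorithm K 0
    query  : ∀ {T} → Distribution K → (Fin K → Bool → Algorithm K T) →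
             Algorithm K (suc T)

  bernoulli : ℝ → Bool → ℝ
  bernoulli q true  = q
  bernoulli q false = 1# - q

  -- Law of the answer when X is compared with x ≉ X; true claims x < X.
  answer : (p X x : ℝ) → Bool → ℝ
  answer p X x = bernoulli (if does (x <? X) then 1# - p else p)

  outputLaw : ∀ {K T} → ℝ → Vec ℝ K → ℝ → Algorithm K T → Fin (suc K) → ℝ
  outputLaw p Xs X (output d)  j = weight d j
  outputLaw p Xs X (query d f) j = sum λ i → weight d i *
    (answer p X (lookup Xs i) true  * outputLaw p Xs X (f i true)  j +
     answer p X (lookup Xs i) false * outputLaw p Xs X (f i false) j)

  open VecMembership setoid public using (_∉_)
  open StrictExtrema _<_ public using (_<±_; ⊥±<[_]; [_]<⊤±)
    renaming ([_] to [_]ˢ)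

  -- X₀ , X₁ , … , X_K , X_{K+1}
  extended : ∀ {K} → Vec ℝ K → Vec (ℝ ±) (suc (suc K))
  extended Xs = ⊥± ∷ (map [_] Xs ∷ʳ ⊤±)

  -- X_i < X < X_{i+1}; at most one i satisfies this when Xs is increasing.
  IsSearchResult : ∀ {K} → Vec ℝ K → ℝ → Fin (suc K) → Set
  IsSearchResult Xs X i =
    (lookup (extended Xs) (inject₁ i) <± [ X ]) ×
    ([ X ] <± lookup (extended Xs) (suc i))

  search : ∀ {K} (Xs : Vec ℝ K) X → X ∉ Xs → ∃ (IsSearchResult Xs X)
  search Xs X X∉Xs = go ⊥± ⊥±<[ X ] Xs X∉Xs
    where
    go : ∀ {n} (l : ℝ ±) → l <± [ X ] → (ys : Vec ℝ n) → X ∉ ys →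
         ∃ λ (i : Fin (suc n)) →
           (lookup (l ∷ (map [_] ys ∷ʳ ⊤±)) (inject₁ i) <± [ X ]) ×
           ([ X ] <± lookup (l ∷ (map [_] ys ∷ʳ ⊤±)) (suc i))
    go l l<X []       _    = zero , l<X , [ X ]<⊤±
    go l l<X (y ∷ ys) X∉ with compare X y
    ... | tri< X<y _   _   = zero , l<X , [ X<y ]ˢ
    ... | tri≈ _   X≈y _   = contradiction (here X≈y) X∉
    ... | tri> _   _   y<X =
      let i , lower , upper = go [ y ] [ y<X ]ˢ ys (λ X∈ → X∉ (there X∈))
      in  suc i , lower , upper

  SEARCH : ∀ {K} (Xs : Vec ℝ K) X → X ∉ Xs → Fin (suc K)
  SEARCH Xs X X∉Xs = proj₁ (search Xs X X∉Xs)

  record SearchProblem : Set where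
    field
      K      : ℕ
      2≤K    : 2 ℕ.≤ K
      Xs     : Vec ℝ K
      sorted : Linked _<_ Xs
      p      : ℝ
      0<p    : 0# < p
      p<½    : p < ½

  0≤sum : ∀ {n} (f : Fin n → ℝ) → (∀ i → 0# ≤ f i) → 0# ≤ sum f
  0≤sum {zero}  f 0≤f = ≤-refl
  0≤sum {suc n} f 0≤f = 0≤x+y (0≤f zero) (0≤sum (λ i → f (suc i)) (λ i → 0≤f (suc i)))

  sum-mono-≤ : ∀ {n} (f g : Fin n → ℝ) → (∀ i → f i ≤ g i) → sum f ≤ sum g
  sum-mono-≤ {zero}  f g f≤g = ≤-refl
  sum-mono-≤ {suc n} f g f≤g =
    +-mono-≤ (f≤g zero) (sum-mono-≤ (λ i → f (suc i)) (λ i → g (suc i)) (λ i → f≤g (suc i)))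

  below : ∀ {n} (ys : Vec ℝ n) → ∃ λ X → X ∉ ys × (∀ {Z} → Z ≤ X → Z ∉ ys)
  below []       = 0# , (λ ()) , λ _ ()
  below (y ∷ ys) =
    let X , _ , X-below = below ys
        Z , Z<y , Z≤X   = smaller y X
        avoids : ∀ {W} → W ≤ Z → W ∉ (y ∷ ys)
        avoids = λ { W≤Z (here W≈y) → <⇒≱ Z<y (≤-trans (≤-reflexive (≈-sym W≈y)) W≤Z)
                   ; W≤Z (there W∈) → X-below (≤-trans W≤Z Z≤X) W∈ }
    in  Z , avoids ≤-refl , avoids
    where
    x-1<x : ∀ x → x - 1# < x
    x-1<x x = begin-strict
      x - 1# <⟨ +-monoʳ-< x (0<x⇒-x<0 0<1) ⟩
      x + 0# ≈⟨ +-identityʳ x ⟩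
      x      ∎

    smaller : ∀ a b → ∃ λ Z → Z < a × Z ≤ b
    smaller a b with ≤-total a b
    ... | inj₁ a≤b = a - 1# , x-1<x a , ≤-trans (<⇒≤ (x-1<x a)) a≤b
    ... | inj₂ (inj₁ b<a) = b , b<a , ≤-refl
    ... | inj₂ (inj₂ b≈a) = b - 1# , <-respʳ-≈ b≈a (x-1<x b) , <⇒≤ (x-1<x b)

  ½<1 : ½ < 1#
  ½<1 = begin-strict
    1# * 2⁻¹                ≈⟨ *-identityˡ 2⁻¹ ⟩
    2⁻¹                     ≈⟨ +-identityʳ 2⁻¹ ⟨
    2⁻¹ + 0#                <⟨ +-monoʳ-< 2⁻¹ (x⁻¹>0 (0<fromℕ 2)) ⟩
    2⁻¹ + 2⁻¹               ≈⟨ +-cong (*-identityʳ 2⁻¹) (*-identityʳ 2⁻¹) ⟨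
    2⁻¹ * 1# + 2⁻¹ * 1#     ≈⟨ distribˡ 2⁻¹ 1# 1# ⟨
    2⁻¹ * (1# + 1#)         ≈⟨ *-congˡ (+-congˡ (+-identityʳ 1#)) ⟨
    2⁻¹ * fromℕ 2           ≈⟨ *-comm _ _ ⟩
    fromℕ 2 * 2⁻¹           ≈⟨ x*x⁻¹≈1 (0<fromℕ 2) ⟩
    1#                      ∎
    where 2⁻¹ = fromℕ 2 ⁻¹

  module _ (P : SearchProblem) where

    open SearchProblem P

    Alg : ℕ → Set
    Alg = Algorithm K

    -- The probability that the output of μ̂ differs from j when the truth is X.
    ℙ[_≢_∣_] : ∀ {T} → Alg T → Fin (suc K) → ℝ → ℝ
    ℙ[ μ̂ ≢ j ∣ X ] =
      sum λ i → if does (i Fin.≟ j) then 0# else outputLaw p Xs X μ̂ i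

    p<1 : p < 1#
    p<1 = <-trans p<½ ½<1

    0≤1-p : 0# ≤ 1# - p
    0≤1-p = <⇒≤ (x<y⇒0<y-x p<1)

    1-[1-p]≈p : 1# - (1# - p) ≈ p
    1-[1-p]≈p = begin-equality
      1# - (1# - p)              ≈⟨ +-congʳ (x-y+y≈x 1# p) ⟨
      (1# - p) + p - (1# - p)    ≈⟨ +-congʳ (+-comm (1# - p) p) ⟩
      p + (1# - p) - (1# - p)    ≈⟨ +-assoc p _ _ ⟩
      p + ((1# - p) - (1# - p))  ≈⟨ +-congˡ (-‿inverseʳ (1# - p)) ⟩
      p + 0#                     ≈⟨ +-identityʳ p ⟩
      p                          ∎

    0≤answer : ∀ X x b → 0# ≤ answer p X x b
    0≤answer X x b with does (x <? X)
    0≤answer X x true  | true  = 0≤1-p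
    0≤answer X x false | true  = ≤-trans (<⇒≤ 0<p) (≤-reflexive (≈-sym 1-[1-p]≈p))
    0≤answer X x true  | false = <⇒≤ 0<p
    0≤answer X x false | false = 0≤1-p

    answer-total : ∀ X x → answer p X x true + answer p X x false ≈ 1#
    answer-total X x = ≈-trans (+-comm _ _) (x-y+y≈x 1# _)

    0≤outputLaw : ∀ {T} (μ̂ : Alg T) X j → 0# ≤ outputLaw p Xs X μ̂ j
    0≤outputLaw (output d)  X j = nonneg d j
    0≤outputLaw (query d f) X j = 0≤sum _ λ i → 0≤x*y (nonneg d i)
      (0≤x+y (0≤x*y (0≤answer X _ true)  (0≤outputLaw (f i true)  X j))
             (0≤x*y (0≤answer X _ false) (0≤outputLaw (f i false) X j)))

    outputLaw-total : ∀ {T} (μ̂ : Alg T) X → sum (outputLaw p Xs X μ̂) ≈ 1#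
    outputLaw-total (output d)  X = normalised d
    outputLaw-total (query d f) X = begin-equality
      sum (λ j → sum (λ i → w i * inner i j))  ≈⟨ ∑-comm (λ j i → w i * inner i j) ⟩
      sum (λ i → sum (λ j → w i * inner i j))  ≈⟨ sum-cong-≋ (λ i → *-distribˡ-sum (w i) (inner i)) ⟨
      sum (λ i → w i * sum (inner i))          ≈⟨ sum-cong-≋ (λ i → *-congˡ (inner-total i)) ⟩
      sum (λ i → w i * 1#)                     ≈⟨ sum-cong-≋ (λ i → *-identityʳ (w i)) ⟩
      sum w                                    ≈⟨ normalised d ⟩
      1#                                       ∎
      where
      w = weight d
      a : Fin K → Bool → ℝ
      a i = answer p X (lookup Xs i)
      law : Fin K → Bool → Fin (suc K) → ℝ
      law i b = outputLaw p Xs X (f i b)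
      inner : Fin K → Fin (suc K) → ℝ
      inner i j = a i true * law i true j + a i false * law i false j

      inner-total : ∀ i → sum (inner i) ≈ 1#
      inner-total i = begin-equality
        sum (inner i)
          ≈⟨ ∑-distrib-+ (λ j → a i true * law i true j) (λ j → a i false * law i false j) ⟩
        sum (λ j → a i true * law i true j) + sum (λ j → a i false * law i false j)
          ≈⟨ +-cong (*-distribˡ-sum (a i true) (law i true))
                    (*-distribˡ-sum (a i false) (law i false)) ⟨
        a i true * sum (law i true) + a i false * sum (law i false)
          ≈⟨ +-cong (*-congˡ (outputLaw-total (f i true) X))
                    (*-congˡ (outputLaw-total (f i false) X)) ⟩
        a i true * 1# + a i false * 1#
          ≈⟨ +-cong (*-identityʳ _) (*-identityʳ _) ⟩
        a i true + a i false
          ≈⟨ answer-total X (lookup Xs i) ⟩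
        1# ∎

    0≤ℙ : ∀ {T} (μ̂ : Alg T) j X → 0# ≤ ℙ[ μ̂ ≢ j ∣ X ]
    0≤ℙ μ̂ j X = 0≤sum _ term
      where
      term : ∀ i → 0# ≤ (if does (i Fin.≟ j) then 0# else outputLaw p Xs X μ̂ i)
      term i with does (i Fin.≟ j)
      ... | true  = ≤-refl
      ... | false = 0≤outputLaw μ̂ X i

    ℙ≤1 : ∀ {T} (μ̂ : Alg T) j X → ℙ[ μ̂ ≢ j ∣ X ] ≤ 1#
    ℙ≤1 μ̂ j X = ≤-trans (sum-mono-≤ _ _ term) (≤-reflexive (outputLaw-total μ̂ X))
      where
      term : ∀ i → (if does (i Fin.≟ j) then 0# else outputLaw p Xs X μ̂ i) ≤
                   outputLaw p Xs X μ̂ i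
      term i with does (i Fin.≟ j)
      ... | true  = 0≤outputLaw μ̂ X i
      ... | false = ≤-refl

    Errors : ∀ {T} → Alg T → Pred ℝ 0ℓ
    Errors μ̂ e = ∃ λ X → ∃ λ (X∉Xs : X ∉ Xs) → e ≈ ℙ[ μ̂ ≢ SEARCH Xs X X∉Xs ∣ X ]

    worstError-spec : ∀ {T} (μ̂ : Alg T) → ∃ (IsSupremum (Errors μ̂))
    worstError-spec μ̂ = complete (Errors μ̂)
      (let X , X∉Xs , _ = below Xs in _ , X , X∉Xs , ≈-refl)
      (1# , λ { (X , X∉Xs , e≈) → ≤-trans (≤-reflexive e≈) (ℙ≤1 μ̂ (SEARCH Xs X X∉Xs) X) })

    -- sup_X ℙ(μ̂ ≠ SEARCH(X))
    worstError : ∀ {T} → Alg T → ℝ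
    worstError μ̂ = proj₁ (worstError-spec μ̂)

    WorstErrors : ℕ → Pred ℝ 0ℓ
    WorstErrors T e = ∃ λ (μ̂ : Alg T) → e ≈ worstError μ̂

    someAlgorithm : ∀ T → Alg T
    someAlgorithm zero    = output (uniform (suc K))
    someAlgorithm (suc T) =
      query (uniform K {{ℕ.>-nonZero (ℕ.≤-trans (ℕ.s≤s ℕ.z≤n) 2≤K)}}) (λ _ _ → someAlgorithm T)

    0≤worstError : ∀ {T} (μ̂ : Alg T) → 0# ≤ worstError μ̂
    0≤worstError μ̂ =
      let X , X∉Xs , _ = below Xs
      in  ≤-trans (0≤ℙ μ̂ (SEARCH Xs X X∉Xs) X) (proj₁ (proj₂ (worstError-spec μ̂)) (X , X∉Xs , ≈-refl))

    minimaxError-spec : ∀ T → ∃ (IsInfimum (WorstErrors T))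
    minimaxError-spec T = infimum (WorstErrors T)
      (_ , someAlgorithm T , ≈-refl)
      (0# , λ { (μ̂ , e≈) → ≤-trans (0≤worstError μ̂) (≤-reflexive (≈-sym e≈)) })

    -- inf_μ̂ sup_X ℙ(μ̂ ≠ SEARCH(X)), over algorithms making T queries
    minimaxError : ℕ → ℝ
    minimaxError T = proj₁ (minimaxError-spec T)

{-# OPTIONS --safe #-}

-- A randomised algorithm is a tree, so the two information inequalities are
-- proved by induction on it, in forms that survive averaging over the next
-- query and its answer.
--
-- Fano: if a is the law of the answers and a′ another one, with divergence at
-- most κ per query, then E_a[v] ≤ Tκ + E_a′[exp v] − 1 for every v on the
-- outputs.  Take a′ to be fair coins, for which κ = log 2 · (1 − H(p)), and v
-- equal to log A at hypothesis h and 0 elsewhere, up to normalisation.  Summing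
-- over the N = K + 1 hypotheses h gives, for the worst error e,
--   (1 − e) log A ≤ Tκ + log ((A + K) / N).
-- A = N² gives the bound 1 − T(1 − H(p)) / log K, and A = N the first term of
-- the query complexity.
--
-- Two points: for laws at divergence at most D per query, the errors at two
-- hypotheses add up to at least exp (− TD) / 2 (Bretagnolle–Huber).  Since
-- κ ≤ D, the first term also absorbs the constant log 4 in
-- log (1/δ) ≤ TD + log 4.

module Submission where

open import Level using (0ℓ)
open import Algebra.Bundles using (RawRing)
import Algebra.Construct.NaturalChoice.Max as NaturalMax
import Algebra.Properties.AbelianGroup as AbelianGroupProperties
import Algebra.Properties.Semiring.Exp as SemiringExp
import Algebra.Solver.Ring as RingSolver
open import Algebra.Solver.Ring.AlmostCommutativeRing
  using (AlmostCommutativeRing; fromCommutativeRing; _-Raw-AlmostCommutative⟶_)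
open import Axiom.ExcludedMiddle using (ExcludedMiddle)
open import Data.Bool.Base using (Bool; true; false; if_then_else_)
open import Data.Fin.Base using (Fin; zero; suc; inject₁; fromℕ<)
import Data.Fin.Properties as Fin
open import Data.Integer.Base as ℤ using (ℤ; +_; -[1+_])
import Data.Integer.Properties as ℤ
open import Data.Maybe.Base using (Maybe; just; nothing)
open import Data.Nat.Base as ℕ using (ℕ; zero; suc)
import Data.Nat.Properties as ℕ
open import Data.Product.Base using (∃; _×_; _,_; proj₁; proj₂)
import Data.Sign.Base as Sign
open import Data.Sum.Base using (_⊎_; inj₁; inj₂)
open import Data.Vec.Base using (Vec; []; _∷_; _∷ʳ_; map; lookup)
open import Data.Vec.Relation.Unary.Any using (here; there)
open import Data.Vec.Relation.Unary.Linked as Linked using (Linked; _∷_)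
open import Function.Base using (_∘_)
import Relation.Binary.PropositionalEquality as ≡
open ≡ using (_≡_; _≢_)
import Relation.Binary.Reasoning.StrictPartialOrder as StrictReasoning
open import Relation.Nullary.Construct.Add.Extrema using (_±; ⊥±; ⊤±; [_])
open import Relation.Nullary.Decidable.Core using (yes; no; does)
open import Relation.Nullary.Negation.Core using (¬_; contradiction)
open import Defs

-- Averaging over queries and answers forces both inequalities into affine form. `log E_a′[exp v]`
-- is replaced by its upper bound `E_a′[exp v] − 1`, and subtracting a constant `log c` from `v`,
-- chosen so that the exponentials average to 1 over the hypotheses, recovers the logarithm. The
-- minimum of 1 and the likelihood ratio is replaced by a lower bound affine in the ratio, whose
-- mean stays 1, and in its logarithm, whose mean drops by at most D per query.
--
-- The size of A is a trade-off. With a = T(1 - H(p)), the claim 4e ≥ 1 - a / log K and the Fano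
-- bound are both affine in a, so the ends a = 0 and a = log K decide. Once Tκ is estimated by a, A
-- = N is too small near a = log K: it would require K(2K + 1) ≤ (K + 1)². The query complexity
-- cannot be read off from the first bound, whose factor 4 makes it empty once δ ≥ 1/4. There Fano
-- must still say something at error 0.49; for K = 2 it does with A = N, but not with A = N².

module SearchBounds (em : ExcludedMiddle 0ℓ) (R : CompleteOrderedField) where

  open Reals em R
  open StrictReasoning strictPartialOrder
  open AbelianGroupProperties +-abelianGroup using (⁻¹-∙-comm)
  open NaturalMax totalOrder using (⊔-lub)
  open SemiringExp semiring using (^-congˡ)

  -- Ordered ring arithmetic

  -- The values at 0 and 1 are 0# and 1# on the nose, so that these literals
  -- can be quoted as solver constants.
  fromℤ : ℤ → ℝ
  fromℤ (+ 0)           = 0#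
  fromℤ (+ 1)           = 1#
  fromℤ (+ suc (suc n)) = fromℕ (suc (suc n))
  fromℤ -[1+ n ]        = - fromℕ (suc n)

  fromℤ-+ : ∀ n → fromℤ (+ n) ≈ fromℕ n
  fromℤ-+ 0             = ≈-refl
  fromℤ-+ 1             = ≈-sym (+-identityʳ 1#)
  fromℤ-+ (suc (suc n)) = ≈-refl

  fromℤ-neg : ∀ i → fromℤ (ℤ.- i) ≈ - fromℤ i
  fromℤ-neg (+ 0)           = ≈-sym -0#≈0#
  fromℤ-neg (+ 1)           = -‿cong (+-identityʳ 1#)
  fromℤ-neg (+ suc (suc n)) = ≈-refl
  fromℤ-neg -[1+ n ]        = ≈-trans (fromℤ-+ (suc n)) (≈-sym (-‿involutive _))

  fromℤ-⊖ : ∀ m n → fromℤ (m ℤ.⊖ n) ≈ fromℕ m - fromℕ n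
  fromℤ-⊖ m zero = begin-equality
    fromℤ (m ℤ.⊖ 0)  ≡⟨ ≡.cong fromℤ (ℤ.⊖-≥ {m} ℕ.z≤n) ⟩
    fromℤ (+ m)      ≈⟨ fromℤ-+ m ⟩
    fromℕ m          ≈⟨ +-identityʳ _ ⟨
    fromℕ m + 0#     ≈⟨ +-congˡ -0#≈0# ⟨
    fromℕ m - 0#     ∎
  fromℤ-⊖ zero (suc n) = ≈-sym (+-identityˡ _)
  fromℤ-⊖ (suc m) (suc n) = begin-equality
    fromℤ (suc m ℤ.⊖ suc n)              ≡⟨ ≡.cong fromℤ (ℤ.[1+m]⊖[1+n]≡m⊖n m n) ⟩
    fromℤ (m ℤ.⊖ n)                      ≈⟨ fromℤ-⊖ m n ⟩
    fromℕ m - fromℕ n                    ≈⟨ +-identityˡ _ ⟨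
    0# + (fromℕ m - fromℕ n)             ≈⟨ +-congʳ (-‿inverseʳ 1#) ⟨
    (1# - 1#) + (fromℕ m - fromℕ n)      ≈⟨ +-assoc 1# (- 1#) _ ⟩
    1# + (- 1# + (fromℕ m - fromℕ n))    ≈⟨ +-congˡ (+-assoc (- 1#) _ _) ⟨
    1# + (- 1# + fromℕ m - fromℕ n)      ≈⟨ +-congˡ (+-congʳ (+-comm (- 1#) _)) ⟩
    1# + (fromℕ m - 1# - fromℕ n)        ≈⟨ +-congˡ (+-assoc _ (- 1#) _) ⟩
    1# + (fromℕ m + (- 1# - fromℕ n))    ≈⟨ +-assoc 1# _ _ ⟨
    fromℕ (suc m) + (- 1# - fromℕ n)     ≈⟨ +-congˡ (⁻¹-∙-comm 1# (fromℕ n)) ⟩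
    fromℕ (suc m) - fromℕ (suc n)        ∎

  fromℤ-homo-+ : ∀ i j → fromℤ (i ℤ.+ j) ≈ fromℤ i + fromℤ j
  fromℤ-homo-+ (+ m) (+ n) = begin-equality
    fromℤ (+ (m ℕ.+ n))        ≈⟨ fromℤ-+ (m ℕ.+ n) ⟩
    fromℕ (m ℕ.+ n)            ≈⟨ ×-homo-+ 1# m n ⟩
    fromℕ m + fromℕ n          ≈⟨ +-cong (fromℤ-+ m) (fromℤ-+ n) ⟨
    fromℤ (+ m) + fromℤ (+ n)  ∎
  fromℤ-homo-+ (+ m) -[1+ n ] = ≈-trans (fromℤ-⊖ m (suc n)) (+-congʳ (≈-sym (fromℤ-+ m)))
  fromℤ-homo-+ -[1+ m ] (+ n) = begin-equality
    fromℤ (n ℤ.⊖ suc m)              ≈⟨ fromℤ-⊖ n (suc m) ⟩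
    fromℕ n - fromℕ (suc m)          ≈⟨ +-comm _ _ ⟩
    - fromℕ (suc m) + fromℕ n        ≈⟨ +-congˡ (fromℤ-+ n) ⟨
    - fromℕ (suc m) + fromℤ (+ n)    ∎
  fromℤ-homo-+ -[1+ m ] -[1+ n ] = begin-equality
    - fromℕ (suc (suc (m ℕ.+ n)))     ≡⟨ ≡.cong (λ k → - fromℕ (suc k)) (ℕ.+-suc m n) ⟨
    - fromℕ (suc m ℕ.+ suc n)         ≈⟨ -‿cong (×-homo-+ 1# (suc m) (suc n)) ⟩
    - (fromℕ (suc m) + fromℕ (suc n)) ≈⟨ ⁻¹-∙-comm _ _ ⟨
    - fromℕ (suc m) - fromℕ (suc n)   ∎

  fromℤ-pos*pos : ∀ m n → fromℤ (+ (m ℕ.* n)) ≈ fromℕ m * fromℕ n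
  fromℤ-pos*pos m n = ≈-trans (fromℤ-+ (m ℕ.* n)) (×1-homo-* m n)

  fromℤ-neg-pos*pos : ∀ m n → fromℤ (Sign.- ℤ.◃ (m ℕ.* n)) ≈ - (fromℕ m * fromℕ n)
  fromℤ-neg-pos*pos m n = begin-equality
    fromℤ (Sign.- ℤ.◃ (m ℕ.* n)) ≡⟨ ≡.cong fromℤ (ℤ.-◃n≡-n (m ℕ.* n)) ⟩
    fromℤ (ℤ.- + (m ℕ.* n))      ≈⟨ fromℤ-neg (+ (m ℕ.* n)) ⟩
    - fromℤ (+ (m ℕ.* n))        ≈⟨ -‿cong (fromℤ-pos*pos m n) ⟩
    - (fromℕ m * fromℕ n)        ∎

  fromℤ-homo-* : ∀ i j → fromℤ (i ℤ.* j) ≈ fromℤ i * fromℤ j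
  fromℤ-homo-* (+ m) (+ n) = begin-equality
    fromℤ (Sign.+ ℤ.◃ (m ℕ.* n))  ≡⟨ ≡.cong fromℤ (ℤ.+◃n≡+n (m ℕ.* n)) ⟩
    fromℤ (+ (m ℕ.* n))           ≈⟨ fromℤ-pos*pos m n ⟩
    fromℕ m * fromℕ n             ≈⟨ *-cong (fromℤ-+ m) (fromℤ-+ n) ⟨
    fromℤ (+ m) * fromℤ (+ n)     ∎
  fromℤ-homo-* (+ m) -[1+ n ] = begin-equality
    fromℤ (Sign.- ℤ.◃ (m ℕ.* suc n)) ≈⟨ fromℤ-neg-pos*pos m (suc n) ⟩
    - (fromℕ m * fromℕ (suc n))      ≈⟨ -‿distribʳ-* _ _ ⟩
    fromℕ m * - fromℕ (suc n)        ≈⟨ *-congʳ (fromℤ-+ m) ⟨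
    fromℤ (+ m) * - fromℕ (suc n)    ∎
  fromℤ-homo-* -[1+ m ] (+ n) = begin-equality
    fromℤ (Sign.- ℤ.◃ (suc m ℕ.* n)) ≈⟨ fromℤ-neg-pos*pos (suc m) n ⟩
    - (fromℕ (suc m) * fromℕ n)      ≈⟨ -‿distribˡ-* _ _ ⟩
    - fromℕ (suc m) * fromℕ n        ≈⟨ *-congˡ (fromℤ-+ n) ⟨
    - fromℕ (suc m) * fromℤ (+ n)    ∎
  fromℤ-homo-* -[1+ m ] -[1+ n ] = begin-equality
    fromℤ (+ (suc m ℕ.* suc n))          ≈⟨ fromℤ-pos*pos (suc m) (suc n) ⟩
    fromℕ (suc m) * fromℕ (suc n)        ≈⟨ -‿involutive _ ⟨
    - - (fromℕ (suc m) * fromℕ (suc n))  ≈⟨ -‿cong (-‿distribʳ-* _ _) ⟩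
    - (fromℕ (suc m) * - fromℕ (suc n))  ≈⟨ -‿distribˡ-* _ _ ⟩
    - fromℕ (suc m) * - fromℕ (suc n)    ∎

  ℤ-rawRing : RawRing 0ℓ 0ℓ
  ℤ-rawRing = record
    { _≈_ = ≡._≡_ ; _+_ = ℤ._+_ ; _*_ = ℤ._*_ ; -_ = ℤ.-_ ; 0# = + 0 ; 1# = + 1 }

  almostCommutativeRing : AlmostCommutativeRing 0ℓ 0ℓ
  almostCommutativeRing = fromCommutativeRing commutativeRing

  fromℤ-morphism : ℤ-rawRing -Raw-AlmostCommutative⟶ almostCommutativeRing
  fromℤ-morphism = record
    { ⟦_⟧ = fromℤ ; +-homo = fromℤ-homo-+ ; *-homo = fromℤ-homo-* ; -‿homo = fromℤ-neg
    ; 0-homo = ≈-refl ; 1-homo = ≈-refl }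

  fromℤ-≟ : ∀ i j → Maybe (fromℤ i ≈ fromℤ j)
  fromℤ-≟ i j with i ℤ.≟ j
  ... | yes ≡.refl = just ≈-refl
  ... | no  _      = nothing

  open RingSolver ℤ-rawRing almostCommutativeRing fromℤ-morphism fromℤ-≟ public
    using (solve; _:=_; _:+_; _:*_; _:-_; :-_; con; Polynomial)

  infix 10 #_
  #_ : ∀ {n} → ℕ → Polynomial n
  # k = con (+ k)

  ≤-by : ∀ {x y} e → 0# ≤ e → y ≈ x + e → x ≤ y
  ≤-by {x} {y} e 0≤e y≈x+e = begin
    x      ≈⟨ +-identityʳ x ⟨
    x + 0# ≤⟨ +-monoʳ-≤ x 0≤e ⟩
    x + e  ≈⟨ y≈x+e ⟨
    y      ∎

  x≤y⇒0≤y-x : ∀ {x y} → x ≤ y → 0# ≤ y - x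
  x≤y⇒0≤y-x {x} {y} x≤y = begin
    0#    ≈⟨ -‿inverseʳ x ⟨
    x - x ≈⟨ +-comm x (- x) ⟩
    - x + x ≤⟨ +-monoʳ-≤ (- x) x≤y ⟩
    - x + y ≈⟨ +-comm (- x) y ⟩
    y - x ∎

  ≤-respˡ : ∀ {x y z} → x ≈ y → x ≤ z → y ≤ z
  ≤-respˡ x≈y = ≤-trans (≤-reflexive (≈-sym x≈y))

  ≤-respʳ : ∀ {x y z} → y ≈ z → x ≤ y → x ≤ z
  ≤-respʳ y≈z x≤y = ≤-trans x≤y (≤-reflexive y≈z)

  0≤x-y⇒y≤x : ∀ {x y} → 0# ≤ x - y → y ≤ x
  0≤x-y⇒y≤x {x} {y} 0≤x-y = ≤-by (x - y) 0≤x-y (solve 2 (λ x y → x := y :+ (x :- y)) ≈-refl x y)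

  <-≤-trans : ∀ {x y z} → x < y → y ≤ z → x < z
  <-≤-trans {x} {y} {z} x<y y≤z = begin-strict
    x <⟨ x<y ⟩
    y ≤⟨ y≤z ⟩
    z ∎

  ≤-<-trans : ∀ {x y z} → x ≤ y → y < z → x < z
  ≤-<-trans {x} {y} {z} x≤y y<z = begin-strict
    x ≤⟨ x≤y ⟩
    y <⟨ y<z ⟩
    z ∎

  *-monoʳ-≤ : ∀ {x y z} → 0# ≤ x → y ≤ z → y * x ≤ z * x
  *-monoʳ-≤ {x} {y} {z} 0≤x y≤z = begin
    y * x ≈⟨ *-comm y x ⟩
    x * y ≤⟨ *-monoˡ-≤ 0≤x y≤z ⟩
    x * z ≈⟨ *-comm x z ⟩
    z * x ∎

  *-cancelˡ-≤ : ∀ {x y z} → 0# < x → x * y ≤ x * z → y ≤ z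
  *-cancelˡ-≤ 0<x xy≤xz = ≮⇒≥ λ z<y → <⇒≱ (*-monoˡ-< 0<x z<y) xy≤xz

  *-cancelˡ : ∀ {x y z} → 0# < x → x * y ≈ x * z → y ≈ z
  *-cancelˡ 0<x xy≈xz = ≤-antisym
    (*-cancelˡ-≤ 0<x (≤-reflexive xy≈xz)) (*-cancelˡ-≤ 0<x (≤-reflexive (≈-sym xy≈xz)))

  x⁻¹*x≈1 : ∀ {x} → 0# < x → x ⁻¹ * x ≈ 1#
  x⁻¹*x≈1 0<x = ≈-trans (*-comm _ _) (x*x⁻¹≈1 0<x)

  x/y*y≈x : ∀ x {y} → 0# < y → x / y * y ≈ x
  x/y*y≈x x {y} 0<y = begin-equality
    x * y ⁻¹ * y   ≈⟨ *-assoc x _ y ⟩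
    x * (y ⁻¹ * y) ≈⟨ *-congˡ (x⁻¹*x≈1 0<y) ⟩
    x * 1#         ≈⟨ *-identityʳ x ⟩
    x              ∎

  0≤x*x : ∀ y → 0# ≤ y * y
  0≤x*x y with ≤-total 0# y
  ... | inj₁ 0≤y = 0≤x*y 0≤y 0≤y
  ... | inj₂ y≤0 = ≤-respʳ (solve 1 (λ y → :- y :* :- y := y :* y) ≈-refl y)
                           (0≤x*y (x≤0⇒0≤-x y≤0) (x≤0⇒0≤-x y≤0))

  2*½≈1 : fromℕ 2 * ½ ≈ 1#
  2*½≈1 = ≈-trans (*-congˡ (*-identityˡ _)) (x*x⁻¹≈1 (0<fromℕ 2))

  halves : ∀ y → y * ½ + y * ½ ≈ y
  halves y = ≈-trans (solve 2 (λ y h → y :* h :+ y :* h := y :* (# 2 :* h)) ≈-refl y ½)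
                     (≈-trans (*-congˡ 2*½≈1) (*-identityʳ y))

  -- The exponential function

  psum : (ℕ → ℝ) → ℕ → ℝ
  psum f zero    = 0#
  psum f (suc n) = psum f n + f n

  psum-head : ∀ f n → psum f (suc n) ≈ f 0 + psum (f ∘ ℕ.suc) n
  psum-head f zero    = +-comm 0# (f 0)
  psum-head f (suc n) = ≈-trans (+-congʳ (psum-head f n)) (+-assoc _ _ _)

  psum-cong : ∀ {f g} → (∀ n → f n ≈ g n) → ∀ n → psum f n ≈ psum g n
  psum-cong f≈g zero    = ≈-refl
  psum-cong f≈g (suc n) = +-cong (psum-cong f≈g n) (f≈g n)

  0≤psum : ∀ {f} → (∀ n → 0# ≤ f n) → ∀ n → 0# ≤ psum f n
  0≤psum 0≤f zero    = ≤-refl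
  0≤psum 0≤f (suc n) = 0≤x+y (0≤psum 0≤f n) (0≤f n)

  psum-step : ∀ {f} → (∀ n → 0# ≤ f n) → ∀ n → psum f n ≤ psum f (suc n)
  psum-step 0≤f n = ≤-by _ (0≤f n) ≈-refl

  psum-mono : ∀ {f} → (∀ n → 0# ≤ f n) → ∀ k n → psum f n ≤ psum f (k ℕ.+ n)
  psum-mono 0≤f zero    n = ≤-refl
  psum-mono 0≤f (suc k) n = ≤-trans (psum-mono 0≤f k n) (psum-step 0≤f (k ℕ.+ n))

  -- The Cauchy product of coefficient sequences. It is peeled from the front of `f`, so inductions
  -- shift `f` and leave `g` fixed.
  conv : (ℕ → ℝ) → (ℕ → ℝ) → ℕ → ℝ
  conv f g zero    = f 0 * g 0
  conv f g (suc n) = f 0 * g (suc n) + conv (f ∘ ℕ.suc) g n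

  conv-cong : ∀ {f f′ g g′} → (∀ n → f n ≈ f′ n) → (∀ n → g n ≈ g′ n) →
              ∀ n → conv f g n ≈ conv f′ g′ n
  conv-cong f≈ g≈ zero    = *-cong (f≈ 0) (g≈ 0)
  conv-cong f≈ g≈ (suc n) = +-cong (*-cong (f≈ 0) (g≈ (suc n))) (conv-cong (f≈ ∘ ℕ.suc) g≈ n)

  conv-+ : ∀ f f′ g n → conv (λ k → f k + f′ k) g n ≈ conv f g n + conv f′ g n
  conv-+ f f′ g zero    = distribʳ _ _ _
  conv-+ f f′ g (suc n) = ≈-trans (+-congˡ (conv-+ (f ∘ ℕ.suc) (f′ ∘ ℕ.suc) g n))
    (solve 5 (λ a b c u v → (a :+ b) :* c :+ (u :+ v) := a :* c :+ u :+ (b :* c :+ v))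
      ≈-refl (f 0) (f′ 0) (g (suc n)) (conv (f ∘ ℕ.suc) g n) (conv (f′ ∘ ℕ.suc) g n))

  conv-*ˡ : ∀ c f g n → conv (λ k → c * f k) g n ≈ c * conv f g n
  conv-*ˡ c f g zero    = *-assoc _ _ _
  conv-*ˡ c f g (suc n) = ≈-trans (+-cong (*-assoc _ _ _) (conv-*ˡ c (f ∘ ℕ.suc) g n))
                                  (≈-sym (distribˡ _ _ _))

  conv-*ʳ : ∀ c f g n → conv f (λ k → c * g k) n ≈ c * conv f g n
  conv-*ʳ c f g zero    = solve 3 (λ a c b → a :* (c :* b) := c :* (a :* b)) ≈-refl (f 0) c (g 0)
  conv-*ʳ c f g (suc n) = ≈-trans (+-congˡ (conv-*ʳ c (f ∘ ℕ.suc) g n))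
    (solve 4 (λ a c b u → a :* (c :* b) :+ c :* u := c :* (a :* b :+ u)) ≈-refl
      (f 0) c (g (suc n)) (conv (f ∘ ℕ.suc) g n))

  0≤conv : ∀ {f g} → (∀ n → 0# ≤ f n) → (∀ n → 0# ≤ g n) → ∀ n → 0# ≤ conv f g n
  0≤conv 0≤f 0≤g zero    = 0≤x*y (0≤f 0) (0≤g 0)
  0≤conv 0≤f 0≤g (suc n) = 0≤x+y (0≤x*y (0≤f 0) (0≤g (suc n))) (0≤conv (0≤f ∘ ℕ.suc) 0≤g n)

  deriv : (ℕ → ℝ) → ℕ → ℝ
  deriv f n = fromℕ (suc n) * f (suc n)

  -- The product rule for formal power series. In the induction the factor n + 2 splits as 1 + (n +
  -- 1): the part n + 1 feeds the hypothesis for the shifted `f`, and the single copy left over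
  -- turns the derivative of the shift into the shift of the derivative.
  conv-leibniz : ∀ f g n → deriv (conv f g) n ≈ conv (deriv f) g n + conv f (deriv g) n
  conv-leibniz f g zero =
    solve 5 (λ c f₀ f₁ g₀ g₁ → c :* (f₀ :* g₁ :+ f₁ :* g₀) := c :* f₁ :* g₀ :+ f₀ :* (c :* g₁))
      ≈-refl (fromℕ 1) (f 0) (f 1) (g 0) (g 1)
  conv-leibniz f g (suc n) = begin-equality
    (1# + c) * (f 0 * g (suc (suc n)) + (f 1 * g (suc n) + Y))
      ≈⟨ solve 6 (λ c f₀ f₁ g₁ g₂ Y →
           (# 1 :+ c) :* (f₀ :* g₂ :+ (f₁ :* g₁ :+ Y)) :=
           (# 1 :+ c) :* (f₀ :* g₂) :+ (f₁ :* g₁ :+ Y) :+ c :* (f₁ :* g₁ :+ Y))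
         ≈-refl c (f 0) (f 1) (g (suc n)) (g (suc (suc n))) Y ⟩
    (1# + c) * (f 0 * g (suc (suc n))) + (f 1 * g (suc n) + Y) + c * conv (f ∘ ℕ.suc) g (suc n)
      ≈⟨ +-congˡ (conv-leibniz (f ∘ ℕ.suc) g n) ⟩
    (1# + c) * (f 0 * g (suc (suc n))) + (f 1 * g (suc n) + Y) + (U + V)
      ≈⟨ solve 8 (λ c f₀ f₁ g₁ g₂ Y U V →
           (# 1 :+ c) :* (f₀ :* g₂) :+ (f₁ :* g₁ :+ Y) :+ (U :+ V) :=
           ((# 1 :+ # 0) :* f₁ :* g₁ :+ (Y :+ U)) :+ (f₀ :* ((# 1 :+ c) :* g₂) :+ V))
         ≈-refl c (f 0) (f 1) (g (suc n)) (g (suc (suc n))) Y U V ⟩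
    (fromℕ 1 * f 1 * g (suc n) + (Y + U)) + (f 0 * ((1# + c) * g (suc (suc n))) + V)
      ≈⟨ +-congʳ (+-congˡ (conv-+ (f ∘ ℕ.suc ∘ ℕ.suc) (deriv (f ∘ ℕ.suc)) g n)) ⟨
    (fromℕ 1 * f 1 * g (suc n) + conv (λ k → f (suc (suc k)) + deriv (f ∘ ℕ.suc) k) g n)
      + conv f (deriv g) (suc n)
      ≈⟨ +-congʳ (+-congˡ (conv-cong (λ k → solve 2 (λ c a → a :+ c :* a := (# 1 :+ c) :* a)
           ≈-refl (fromℕ (suc k)) (f (suc (suc k)))) (λ _ → ≈-refl) n)) ⟩
    conv (deriv f) g (suc n) + conv f (deriv g) (suc n) ∎
    where
    c = fromℕ (suc n)
    Y = conv (f ∘ ℕ.suc ∘ ℕ.suc) g n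
    U = conv (deriv (f ∘ ℕ.suc)) g n
    V = conv (f ∘ ℕ.suc) (deriv g) n

  psum-conv : ∀ f g n → psum (conv f g) (suc n) ≈ f 0 * psum g (suc n) + psum (conv (f ∘ ℕ.suc) g) n
  psum-conv f g zero    = solve 2 (λ a b → # 0 :+ a :* b := a :* (# 0 :+ b) :+ # 0) ≈-refl (f 0) (g 0)
  psum-conv f g (suc n) = ≈-trans (+-congʳ (psum-conv f g n))
    (solve 5 (λ a G P b u → a :* G :+ P :+ (a :* b :+ u) := a :* (G :+ b) :+ (P :+ u)) ≈-refl
      (f 0) (psum g (suc n)) (psum (conv (f ∘ ℕ.suc) g) n) (g (suc n)) (conv (f ∘ ℕ.suc) g n))

  -- The left side sums the products with indices in the triangle k + l < n, which lies in the
  -- square k, l < n.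
  psum-conv-≤ : ∀ {f g} → (∀ n → 0# ≤ f n) → (∀ n → 0# ≤ g n) → ∀ n →
                psum (conv f g) n ≤ psum f n * psum g n
  psum-conv-≤ 0≤f 0≤g zero = ≤-reflexive (≈-sym (zeroˡ _))
  psum-conv-≤ {f} {g} 0≤f 0≤g (suc n) = begin
    psum (conv f g) (suc n)
      ≈⟨ psum-conv f g n ⟩
    f 0 * psum g (suc n) + psum (conv (f ∘ ℕ.suc) g) n
      ≤⟨ +-monoʳ-≤ _ (psum-conv-≤ (0≤f ∘ ℕ.suc) 0≤g n) ⟩
    f 0 * psum g (suc n) + psum (f ∘ ℕ.suc) n * psum g n
      ≤⟨ +-monoʳ-≤ _ (*-monoˡ-≤ (0≤psum (0≤f ∘ ℕ.suc) n) (psum-step 0≤g n)) ⟩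
    f 0 * psum g (suc n) + psum (f ∘ ℕ.suc) n * psum g (suc n)
      ≈⟨ distribʳ _ _ _ ⟨
    (f 0 + psum (f ∘ ℕ.suc) n) * psum g (suc n)
      ≈⟨ *-congʳ (psum-head f n) ⟨
    psum f (suc n) * psum g (suc n) ∎

  -- Conversely, the rectangle k < m, l < n lies in the triangle k + l < m + n.
  psum-conv-≥ : ∀ {f g} → (∀ n → 0# ≤ f n) → (∀ n → 0# ≤ g n) → ∀ m n →
                psum f m * psum g n ≤ psum (conv f g) (m ℕ.+ n)
  psum-conv-≥ 0≤f 0≤g zero n = ≤-respˡ (≈-sym (zeroˡ _)) (0≤psum (0≤conv 0≤f 0≤g) n)
  psum-conv-≥ {f} {g} 0≤f 0≤g (suc m) n = begin
    psum f (suc m) * psum g n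
      ≈⟨ *-congʳ (psum-head f m) ⟩
    (f 0 + psum (f ∘ ℕ.suc) m) * psum g n
      ≈⟨ distribʳ _ _ _ ⟩
    f 0 * psum g n + psum (f ∘ ℕ.suc) m * psum g n
      ≤⟨ +-mono-≤ (*-monoˡ-≤ (0≤f 0) (psum-mono 0≤g (suc m) n)) (psum-conv-≥ (0≤f ∘ ℕ.suc) 0≤g m n) ⟩
    f 0 * psum g (suc (m ℕ.+ n)) + psum (conv (f ∘ ℕ.suc) g) (m ℕ.+ n)
      ≈⟨ psum-conv f g (m ℕ.+ n) ⟨
    psum (conv f g) (suc m ℕ.+ n) ∎

  expTerm-0 : ∀ x → expTerm x 0 ≈ 1#
  expTerm-0 x = ≈-trans (*-congʳ (≈-sym (+-identityʳ 1#))) (x*x⁻¹≈1 (0<fromℕ 1))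

  -- The binomial theorem, obtained without binomial coefficients: by `conv-leibniz` both sides
  -- satisfy (n + 1) z(n + 1) = (x + y) z(n), and they agree at 0.
  expTerm-+ : ∀ x y n → conv (expTerm x) (expTerm y) n ≈ expTerm (x + y) n
  expTerm-+ x y zero = begin-equality
    expTerm x 0 * expTerm y 0 ≈⟨ *-cong (expTerm-0 x) (expTerm-0 y) ⟩
    1# * 1#                   ≈⟨ *-identityˡ 1# ⟩
    1#                        ≈⟨ expTerm-0 (x + y) ⟨
    expTerm (x + y) 0         ∎
  expTerm-+ x y (suc n) = *-cancelˡ (0<fromℕ (suc n)) (begin-equality
    deriv (conv t u) n                                       ≈⟨ conv-leibniz t u n ⟩
    conv (deriv t) u n + conv t (deriv u) n                  ≈⟨ +-cong
      (conv-cong (expTerm-step x) (λ _ → ≈-refl) n) (conv-cong (λ _ → ≈-refl) (expTerm-step y) n) ⟩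
    conv (λ k → x * t k) u n + conv t (λ k → y * u k) n      ≈⟨ +-cong (conv-*ˡ x t u n) (conv-*ʳ y t u n) ⟩
    x * conv t u n + y * conv t u n                          ≈⟨ distribʳ _ x y ⟨
    (x + y) * conv t u n                                     ≈⟨ *-congˡ (expTerm-+ x y n) ⟩
    (x + y) * expTerm (x + y) n                              ≈⟨ expTerm-step (x + y) n ⟨
    fromℕ (suc n) * expTerm (x + y) (suc n)                  ∎)
    where
    t = expTerm x
    u = expTerm y

  expSum≈psum : ∀ x n → expSum x n ≈ psum (expTerm x) n
  expSum≈psum x zero    = ≈-refl
  expSum≈psum x (suc n) = +-congʳ (expSum≈psum x n)

  expSum-cong : ∀ {x y} → x ≈ y → ∀ n → expSum x n ≈ expSum y n
  expSum-cong x≈y zero    = ≈-refl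
  expSum-cong x≈y (suc n) = +-cong (expSum-cong x≈y n) (*-congʳ (^-congˡ n x≈y))

  0≤expSum : ∀ {x} → 0# ≤ x → ∀ n → 0# ≤ expSum x n
  0≤expSum {x} 0≤x n = ≤-respʳ (≈-sym (expSum≈psum x n)) (0≤psum (0≤expTerm 0≤x) n)

  expSum-+-≤ : ∀ {x y} → 0# ≤ x → 0# ≤ y → ∀ n → expSum (x + y) n ≤ expSum x n * expSum y n
  expSum-+-≤ {x} {y} 0≤x 0≤y n = begin
    expSum (x + y) n                           ≈⟨ expSum≈psum (x + y) n ⟩
    psum (expTerm (x + y)) n                   ≈⟨ psum-cong (expTerm-+ x y) n ⟨
    psum (conv (expTerm x) (expTerm y)) n      ≤⟨ psum-conv-≤ (0≤expTerm 0≤x) (0≤expTerm 0≤y) n ⟩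
    psum (expTerm x) n * psum (expTerm y) n    ≈⟨ *-cong (expSum≈psum x n) (expSum≈psum y n) ⟨
    expSum x n * expSum y n                    ∎

  expSum-+-≥ : ∀ {x y} → 0# ≤ x → 0# ≤ y → ∀ m n →
               expSum x m * expSum y n ≤ expSum (x + y) (m ℕ.+ n)
  expSum-+-≥ {x} {y} 0≤x 0≤y m n = begin
    expSum x m * expSum y n                        ≈⟨ *-cong (expSum≈psum x m) (expSum≈psum y n) ⟩
    psum (expTerm x) m * psum (expTerm y) n        ≤⟨ psum-conv-≥ (0≤expTerm 0≤x) (0≤expTerm 0≤y) m n ⟩
    psum (conv (expTerm x) (expTerm y)) (m ℕ.+ n)  ≈⟨ psum-cong (expTerm-+ x y) (m ℕ.+ n) ⟩
    psum (expTerm (x + y)) (m ℕ.+ n)               ≈⟨ expSum≈psum (x + y) (m ℕ.+ n) ⟨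
    expSum (x + y) (m ℕ.+ n)                       ∎

  expSum≤expNonneg : ∀ {x} (0≤x : 0# ≤ x) n → expSum x n ≤ expNonneg x 0≤x
  expSum≤expNonneg {x} 0≤x n = proj₁ (proj₂ (expNonneg-spec x 0≤x)) (n , ≈-refl)

  -- Moves a nonnegative factor past the supremum. Applied once in each variable, it bounds a
  -- product of two suprema by bounding products of partial sums. Division by c requires c > 0, so c
  -- = 0 is settled by the empty partial sum.
  expNonneg*c≤ : ∀ {x} (0≤x : 0# ≤ x) {c b} → 0# ≤ c → (∀ n → expSum x n * c ≤ b) →
                 expNonneg x 0≤x * c ≤ b
  expNonneg*c≤ {x} 0≤x {c} {b} (inj₂ 0≈c) bound = begin
    expNonneg x 0≤x * c   ≈⟨ *-congˡ 0≈c ⟨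
    expNonneg x 0≤x * 0#  ≈⟨ zeroʳ _ ⟩
    0#                    ≈⟨ zeroˡ c ⟨
    0# * c                ≤⟨ bound 0 ⟩
    b                     ∎
  expNonneg*c≤ {x} 0≤x {c} {b} (inj₁ 0<c) bound = begin
    expNonneg x 0≤x * c   ≤⟨ *-monoʳ-≤ (<⇒≤ 0<c) (proj₂ (proj₂ (expNonneg-spec x 0≤x)) upper) ⟩
    b / c * c             ≈⟨ x/y*y≈x b 0<c ⟩
    b                     ∎
    where
    upper : UpperBound (ExpSums x) (b / c)
    upper {y} (n , y≈) = *-cancelˡ-≤ 0<c (begin
      c * y           ≈⟨ *-comm c y ⟩
      y * c           ≈⟨ *-congʳ y≈ ⟩
      expSum x n * c  ≤⟨ bound n ⟩
      b               ≈⟨ x/y*y≈x b 0<c ⟨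
      b / c * c       ≈⟨ *-comm _ c ⟩
      c * (b / c)     ∎)

  0<expNonneg : ∀ {x} (0≤x : 0# ≤ x) → 0# < expNonneg x 0≤x
  0<expNonneg {x} 0≤x = ≤-<-trans 0≤x (x<expNonneg x 0≤x)

  -- `z` is kept apart from `x + y` because `expNonneg` takes a proof of nonnegativity, and its
  -- invariance under `≈` is not yet available.
  expNonneg-+ : ∀ {x y z} (0≤x : 0# ≤ x) (0≤y : 0# ≤ y) (0≤z : 0# ≤ z) → z ≈ x + y →
                expNonneg z 0≤z ≈ expNonneg x 0≤x * expNonneg y 0≤y
  expNonneg-+ {x} {y} {z} 0≤x 0≤y 0≤z z≈x+y = ≤-antisym
    (proj₂ (proj₂ (expNonneg-spec z 0≤z)) λ { {s} (n , s≈) → begin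
      s                        ≈⟨ s≈ ⟩
      expSum z n               ≈⟨ expSum-cong z≈x+y n ⟩
      expSum (x + y) n         ≤⟨ expSum-+-≤ 0≤x 0≤y n ⟩
      expSum x n * expSum y n  ≤⟨ *-monoˡ-≤ (0≤expSum 0≤x n) (expSum≤expNonneg 0≤y n) ⟩
      expSum x n * Ey          ≤⟨ *-monoʳ-≤ (<⇒≤ (0<expNonneg 0≤y)) (expSum≤expNonneg 0≤x n) ⟩
      Ex * Ey                  ∎ })
    (expNonneg*c≤ 0≤x (<⇒≤ (0<expNonneg 0≤y)) λ m → ≤-respˡ (*-comm Ey _)
      (expNonneg*c≤ 0≤y (0≤expSum 0≤x m) λ n → begin
        expSum y n * expSum x m   ≈⟨ *-comm _ _ ⟩
        expSum x m * expSum y n   ≤⟨ expSum-+-≥ 0≤x 0≤y m n ⟩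
        expSum (x + y) (m ℕ.+ n)  ≈⟨ expSum-cong z≈x+y (m ℕ.+ n) ⟨
        expSum z (m ℕ.+ n)        ≤⟨ expSum≤expNonneg 0≤z (m ℕ.+ n) ⟩
        Ez                        ∎))
    where
    Ex = expNonneg x 0≤x
    Ey = expNonneg y 0≤y
    Ez = expNonneg z 0≤z

  -- Describes `exp x` uniformly through any splitting x = a - b into nonnegative parts. Congruence
  -- and additivity then follow from `expNonneg-+` with no case distinction on signs.
  exp-quotient : ∀ {x a b} (0≤a : 0# ≤ a) (0≤b : 0# ≤ b) → x + b ≈ a →
                 exp x * expNonneg b 0≤b ≈ expNonneg a 0≤a
  exp-quotient {x} {a} {b} 0≤a 0≤b x+b≈a with ≤-total 0# x
  ... | inj₁ 0≤x = ≈-sym (expNonneg-+ 0≤x 0≤b 0≤a (≈-sym x+b≈a))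
  ... | inj₂ x≤0 = begin-equality
    E ⁻¹ * expNonneg b 0≤b           ≈⟨ *-congˡ (expNonneg-+ 0≤-x 0≤a 0≤b (begin-equality
      b               ≈⟨ solve 2 (λ x b → b := :- x :+ (x :+ b)) ≈-refl x b ⟩
      - x + (x + b)   ≈⟨ +-congˡ x+b≈a ⟩
      - x + a         ∎)) ⟩
    E ⁻¹ * (E * expNonneg a 0≤a)     ≈⟨ *-assoc _ _ _ ⟨
    E ⁻¹ * E * expNonneg a 0≤a       ≈⟨ *-congʳ (x⁻¹*x≈1 (0<expNonneg 0≤-x)) ⟩
    1# * expNonneg a 0≤a             ≈⟨ *-identityˡ _ ⟩
    expNonneg a 0≤a                  ∎
    where
    0≤-x = x≤0⇒0≤-x x≤0
    E = expNonneg (- x) 0≤-x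

  difference : ∀ x → ∃ λ a → ∃ λ b → 0# ≤ a × 0# ≤ b × x + b ≈ a
  difference x with ≤-total 0# x
  ... | inj₁ 0≤x = x , 0# , 0≤x , ≤-refl , +-identityʳ x
  ... | inj₂ x≤0 = 0# , - x , ≤-refl , x≤0⇒0≤-x x≤0 , -‿inverseʳ x

  *-cancelʳ : ∀ {x y z} → 0# < x → y * x ≈ z * x → y ≈ z
  *-cancelʳ 0<x yx≈zx = *-cancelˡ 0<x (≈-trans (*-comm _ _) (≈-trans yx≈zx (*-comm _ _)))

  exp-cong : ∀ {x y} → x ≈ y → exp x ≈ exp y
  exp-cong {x} x≈y with difference x
  ... | a , b , 0≤a , 0≤b , x+b≈a = *-cancelʳ (0<expNonneg 0≤b) (≈-trans
    (exp-quotient 0≤a 0≤b x+b≈a)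
    (≈-sym (exp-quotient 0≤a 0≤b (≈-trans (+-congʳ (≈-sym x≈y)) x+b≈a))))

  exp-+ : ∀ x y → exp (x + y) ≈ exp x * exp y
  exp-+ x y with difference x | difference y
  ... | a , b , 0≤a , 0≤b , x+b≈a | c , d , 0≤c , 0≤d , y+d≈c =
    *-cancelʳ (0<expNonneg 0≤b+d) (begin-equality
      exp (x + y) * expNonneg (b + d) 0≤b+d
        ≈⟨ exp-quotient 0≤a+c 0≤b+d (begin-equality
             x + y + (b + d)   ≈⟨ solve 4 (λ x y b d → x :+ y :+ (b :+ d) := x :+ b :+ (y :+ d))
                                    ≈-refl x y b d ⟩
             x + b + (y + d)   ≈⟨ +-cong x+b≈a y+d≈c ⟩
             a + c             ∎) ⟩
      expNonneg (a + c) 0≤a+c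
        ≈⟨ expNonneg-+ 0≤a 0≤c 0≤a+c ≈-refl ⟩
      expNonneg a 0≤a * expNonneg c 0≤c
        ≈⟨ *-cong (exp-quotient 0≤a 0≤b x+b≈a) (exp-quotient 0≤c 0≤d y+d≈c) ⟨
      exp x * B * (exp y * D)
        ≈⟨ solve 4 (λ x y b d → x :* b :* (y :* d) := x :* y :* (b :* d)) ≈-refl (exp x) (exp y) B D ⟩
      exp x * exp y * (B * D)
        ≈⟨ *-congˡ (expNonneg-+ 0≤b 0≤d 0≤b+d ≈-refl) ⟨
      exp x * exp y * expNonneg (b + d) 0≤b+d ∎)
    where
    0≤a+c = 0≤x+y 0≤a 0≤c
    0≤b+d = 0≤x+y 0≤b 0≤d
    B = expNonneg b 0≤b
    D = expNonneg d 0≤d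

  0<exp : ∀ x → 0# < exp x
  0<exp x with ≤-total 0# x
  ... | inj₁ 0≤x = 0<expNonneg 0≤x
  ... | inj₂ x≤0 = x⁻¹>0 (0<expNonneg (x≤0⇒0≤-x x≤0))

  exp-0 : exp 0# ≈ 1#
  exp-0 = *-cancelˡ (0<exp 0#) (begin-equality
    exp 0# * exp 0#  ≈⟨ exp-+ 0# 0# ⟨
    exp (0# + 0#)    ≈⟨ exp-cong (+-identityʳ 0#) ⟩
    exp 0#           ≈⟨ *-identityʳ _ ⟨
    exp 0# * 1#      ∎)

  expTerm-suc≤ : ∀ {x} → 0# ≤ x → ∀ n → expTerm x (suc n) ≤ x * expTerm x n
  expTerm-suc≤ {x} 0≤x n = begin
    expTerm x (suc n)                   ≈⟨ *-identityˡ _ ⟨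
    1# * expTerm x (suc n)              ≤⟨ *-monoʳ-≤ (0≤expTerm 0≤x (suc n)) (≤-by _ (0≤fromℕ n) ≈-refl) ⟩
    fromℕ (suc n) * expTerm x (suc n)   ≈⟨ expTerm-step x n ⟩
    x * expTerm x n                     ∎

  -- Consecutive terms have ratio x / (n + 1) ≤ x, so past its first term the series is dominated by
  -- x times itself.
  expSum-suc≤ : ∀ {x} → 0# ≤ x → ∀ n → expSum x (suc n) ≤ 1# + x * expSum x n
  expSum-suc≤ {x} 0≤x zero = ≤-reflexive (≈-trans (+-congˡ (expTerm-0 x))
    (solve 1 (λ x → # 0 :+ # 1 := # 1 :+ x :* # 0) ≈-refl x))
  expSum-suc≤ {x} 0≤x (suc n) = begin
    expSum x (suc n) + expTerm x (suc n)       ≤⟨ +-mono-≤ (expSum-suc≤ 0≤x n) (expTerm-suc≤ 0≤x n) ⟩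
    1# + x * expSum x n + x * expTerm x n      ≈⟨ solve 3 (λ x s t →
      # 1 :+ x :* s :+ x :* t := # 1 :+ x :* (s :+ t)) ≈-refl x (expSum x n) (expTerm x n) ⟩
    1# + x * expSum x (suc n)                  ∎

  -- This is exp x ≤ 1 / (1 - x) at the level of partial sums. Passing to the supremum gives the
  -- tangent inequality `1+x≤exp` at negative arguments.
  expSum*[1-x]≤1 : ∀ {x} → 0# ≤ x → ∀ n → expSum x n * (1# - x) ≤ 1#
  expSum*[1-x]≤1 {x} 0≤x n = begin
    S * (1# - x)             ≈⟨ solve 2 (λ x s → s :* (# 1 :- x) := s :- x :* s) ≈-refl x S ⟩
    S - x * S                ≤⟨ ≤-by t (0≤expTerm 0≤x n) (solve 3 (λ s t u → s :+ t :- u := s :- u :+ t) ≈-refl S t (x * S)) ⟩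
    S + t - x * S            ≈⟨ +-comm _ _ ⟩
    - (x * S) + (S + t)      ≤⟨ +-monoʳ-≤ _ (expSum-suc≤ 0≤x n) ⟩
    - (x * S) + (1# + x * S) ≈⟨ solve 1 (λ u → :- u :+ (# 1 :+ u) := # 1) ≈-refl (x * S) ⟩
    1#                       ∎
    where
    S = expSum x n
    t = expTerm x n

  1+x≤exp : ∀ x → 1# + x ≤ exp x
  1+x≤exp x with ≤-total 0# x
  ... | inj₁ 0≤x = 1+x≤expNonneg x 0≤x
  ... | inj₂ x≤0 with ≤-total 0# (1# + x)
  ...   | inj₂ 1+x≤0 = ≤-trans 1+x≤0 (<⇒≤ (x⁻¹>0 (0<expNonneg (x≤0⇒0≤-x x≤0))))
  ...   | inj₁ 0≤1+x = *-cancelˡ-≤ 0<E (begin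
    E * (1# + x)    ≤⟨ expNonneg*c≤ 0≤-x 0≤1+x (λ n →
      ≤-respˡ (*-congˡ (+-congˡ (-‿involutive x))) (expSum*[1-x]≤1 0≤-x n)) ⟩
    1#              ≈⟨ x*x⁻¹≈1 0<E ⟨
    E * E ⁻¹        ∎)
    where
    0≤-x = x≤0⇒0≤-x x≤0
    E = expNonneg (- x) 0≤-x
    0<E = 0<expNonneg 0≤-x

  -- The logarithm

  exp-mono-< : ∀ {x y} → x < y → exp x < exp y
  exp-mono-< {x} {y} x<y = begin-strict
    exp x                    ≈⟨ *-identityʳ _ ⟨
    exp x * 1#               <⟨ *-monoˡ-< (0<exp x) (begin-strict
      1#            ≈⟨ +-identityʳ 1# ⟨
      1# + 0#       <⟨ +-monoʳ-< 1# (x<y⇒0<y-x x<y) ⟩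
      1# + (y - x)  ≤⟨ 1+x≤exp (y - x) ⟩
      exp (y - x)   ∎) ⟩
    exp x * exp (y - x)      ≈⟨ exp-+ x (y - x) ⟨
    exp (x + (y - x))        ≈⟨ exp-cong (solve 2 (λ x y → x :+ (y :- x) := y) ≈-refl x y) ⟩
    exp y                    ∎

  exp-mono-≤ : ∀ {x y} → x ≤ y → exp x ≤ exp y
  exp-mono-≤ (inj₁ x<y) = <⇒≤ (exp-mono-< x<y)
  exp-mono-≤ (inj₂ x≈y) = ≤-reflexive (exp-cong x≈y)

  exp-cancel-≤ : ∀ {x y} → exp x ≤ exp y → x ≤ y
  exp-cancel-≤ eˣ≤eʸ = ≮⇒≥ λ y<x → <⇒≱ (exp-mono-< y<x) eˣ≤eʸ

  exp-injective : ∀ {x y} → exp x ≈ exp y → x ≈ y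
  exp-injective eˣ≈eʸ = ≤-antisym
    (exp-cancel-≤ (≤-reflexive eˣ≈eʸ)) (exp-cancel-≤ (≤-reflexive (≈-sym eˣ≈eʸ)))

  exp*exp-neg≈1 : ∀ x → exp x * exp (- x) ≈ 1#
  exp*exp-neg≈1 x = begin-equality
    exp x * exp (- x)  ≈⟨ exp-+ x (- x) ⟨
    exp (x - x)        ≈⟨ exp-cong (-‿inverseʳ x) ⟩
    exp 0#             ≈⟨ exp-0 ⟩
    1#                 ∎

  exp*[1-x]≤1 : ∀ x → exp x * (1# - x) ≤ 1#
  exp*[1-x]≤1 x = begin
    exp x * (1# - x)   ≤⟨ *-monoˡ-≤ (<⇒≤ (0<exp x)) (1+x≤exp (- x)) ⟩
    exp x * exp (- x)  ≈⟨ exp*exp-neg≈1 x ⟩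
    1#                 ∎

  log-supremum : ∀ {y} → 0# < y → IsSupremum (ExpBelow y) (log y)
  log-supremum {y} 0<y with 0# <? y
  ... | yes 0<y′ = proj₂ (log-spec y 0<y′)
  ... | no  0≮y  = contradiction 0<y 0≮y

  x-h<x : ∀ {h} x → 0# < h → x - h < x
  x-h<x x 0<h = <-respʳ-≈ (+-identityʳ x) (+-monoʳ-< x (0<x⇒-x<0 0<h))

  x<x+h : ∀ {h} x → 0# < h → x < x + h
  x<x+h x 0<h = <-respˡ-≈ (+-identityʳ x) (+-monoʳ-< x 0<h)

  -- The tangent inequality takes the role of continuity: if exp s differed from y, a definite step
  -- h would move s towards the right value without overshooting, contradicting leastness or the
  -- upper bound property.
  exp-log : ∀ {y} → 0# < y → exp (log y) ≈ y
  exp-log {y} 0<y = ≤-antisym (≮⇒≥ not-above) (≮⇒≥ not-below)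
    where
    s = log y
    upper = proj₁ (log-supremum 0<y)
    least = proj₂ (log-supremum 0<y)

    -- h = 1 − y / exp s makes exp (s − h) ≥ exp s * (1 − h) = y.
    not-above : ¬ y < exp s
    not-above y<eˢ = <⇒≱ (x-h<x s 0<h) (least λ {x} eˣ≤y → exp-cancel-≤ (≤-trans eˣ≤y y≤))
      where
      h = 1# - y / exp s
      0<h : 0# < h
      0<h = x<y⇒0<y-x (begin-strict
        y / exp s        <⟨ <-respʳ-≈ (*-comm _ _) (<-respˡ-≈ (*-comm _ _)
                              (*-monoˡ-< (x⁻¹>0 (0<exp s)) y<eˢ)) ⟩
        exp s / exp s    ≈⟨ x*x⁻¹≈1 (0<exp s) ⟩
        1#               ∎)
      y≤ : y ≤ exp (s - h)
      y≤ = begin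
        y                      ≈⟨ x/y*y≈x y (0<exp s) ⟨
        y / exp s * exp s      ≈⟨ solve 2 (λ q e → q :* e := e :* (# 1 :+ :- (# 1 :- q))) ≈-refl (y / exp s) (exp s) ⟩
        exp s * (1# - h)       ≤⟨ *-monoˡ-≤ (<⇒≤ (0<exp s)) (1+x≤exp (- h)) ⟩
        exp s * exp (- h)      ≈⟨ exp-+ s (- h) ⟨
        exp (s - h)            ∎

    not-below : ¬ exp s < y
    not-below eˢ<y = <⇒≱ (x<x+h s 0<h) (upper (begin
      exp (s + h)                        ≈⟨ exp-+ s h ⟩
      exp s * exp h                      ≈⟨ *-congʳ (x/y*y≈x (exp s) 0<y) ⟨
      exp s / y * y * exp h              ≈⟨ solve 3 (λ q y e → q :* y :* e := y :* (e :* (# 1 :- (# 1 :- q)))) ≈-refl (exp s / y) y (exp h) ⟩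
      y * (exp h * (1# - h))             ≤⟨ *-monoˡ-≤ (<⇒≤ 0<y) (exp*[1-x]≤1 h) ⟩
      y * 1#                             ≈⟨ *-identityʳ y ⟩
      y                                  ∎))
      where
      -- The mirror image of `not-above`: exp (s + h) = y · exp h · (1 - h) ≤ y, so s + h is still
      -- in the set.
      h = 1# - exp s / y
      0<h : 0# < h
      0<h = x<y⇒0<y-x (begin-strict
        exp s / y        <⟨ <-respʳ-≈ (*-comm _ _) (<-respˡ-≈ (*-comm _ _)
                              (*-monoˡ-< (x⁻¹>0 0<y) eˢ<y)) ⟩
        y / y            ≈⟨ x*x⁻¹≈1 0<y ⟩
        1#               ∎)

  log≈ : ∀ {x y} → 0# < x → exp y ≈ x → log x ≈ y
  log≈ 0<x eʸ≈x = exp-injective (≈-trans (exp-log 0<x) (≈-sym eʸ≈x))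

  log-cong : ∀ {x y} → 0# < x → x ≈ y → log x ≈ log y
  log-cong 0<x x≈y = log≈ 0<x (≈-trans (exp-log (<-respʳ-≈ x≈y 0<x)) (≈-sym x≈y))

  log-1 : log 1# ≈ 0#
  log-1 = log≈ 0<1 exp-0

  log-* : ∀ {x y} → 0# < x → 0# < y → log (x * y) ≈ log x + log y
  log-* 0<x 0<y = log≈ (*-pos 0<x 0<y) (≈-trans (exp-+ _ _) (*-cong (exp-log 0<x) (exp-log 0<y)))

  log-⁻¹ : ∀ {x} → 0# < x → log (x ⁻¹) ≈ - log x
  log-⁻¹ {x} 0<x = begin-equality
    log (x ⁻¹)                     ≈⟨ solve 2 (λ a b → b := :- a :+ (a :+ b)) ≈-refl (log x) (log (x ⁻¹)) ⟩
    - log x + (log x + log (x ⁻¹)) ≈⟨ +-congˡ (log-* 0<x (x⁻¹>0 0<x)) ⟨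
    - log x + log (x * x ⁻¹)       ≈⟨ +-congˡ (log-cong (*-pos 0<x (x⁻¹>0 0<x)) (x*x⁻¹≈1 0<x)) ⟩
    - log x + log 1#               ≈⟨ +-congˡ log-1 ⟩
    - log x + 0#                   ≈⟨ +-identityʳ _ ⟩
    - log x                        ∎

  log-/ : ∀ {x y} → 0# < x → 0# < y → log (x / y) ≈ log x - log y
  log-/ 0<x 0<y = ≈-trans (log-* 0<x (x⁻¹>0 0<y)) (+-congˡ (log-⁻¹ 0<y))

  log-mono-≤ : ∀ {x y} → 0# < x → x ≤ y → log x ≤ log y
  log-mono-≤ 0<x x≤y = exp-cancel-≤
    (≤-respˡ (≈-sym (exp-log 0<x)) (≤-respʳ (≈-sym (exp-log (<-≤-trans 0<x x≤y))) x≤y))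

  log≤x-1 : ∀ {x} → 0# < x → log x ≤ x - 1#
  log≤x-1 {x} 0<x = begin
    log x                ≈⟨ solve 1 (λ l → l := # 1 :+ l :- # 1) ≈-refl (log x) ⟩
    1# + log x - 1#      ≤⟨ +-mono-≤ (1+x≤exp (log x)) ≤-refl ⟩
    exp (log x) - 1#     ≈⟨ +-congʳ (exp-log 0<x) ⟩
    x - 1#               ∎

  0<log : ∀ {x} → 1# < x → 0# < log x
  0<log {x} 1<x with 0# <? log x
  ... | yes 0<l = 0<l
  ... | no  0≮l = contradiction (begin
    x            ≈⟨ exp-log (<-trans 0<1 1<x) ⟨
    exp (log x)  ≤⟨ exp-mono-≤ (≮⇒≥ 0≮l) ⟩
    exp 0#       ≈⟨ exp-0 ⟩
    1#           ∎) (<⇒≱ 1<x)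

  -- Information inequalities for algorithms

  sum-const : ∀ n x → sum {n} (λ _ → x) ≈ fromℕ n * x
  sum-const zero    x = ≈-sym (zeroˡ x)
  sum-const (suc n) x = ≈-trans (+-congˡ (sum-const n x))
    (solve 2 (λ m x → x :+ m :* x := (# 1 :+ m) :* x) ≈-refl (fromℕ n) x)

  sum-≟ : ∀ {n} (j : Fin (suc n)) x y →
          sum (λ k → if does (j Fin.≟ k) then x else y) ≈ x + fromℕ n * y
  sum-≟ {n}     zero    x y = +-congˡ (sum-const n y)
  sum-≟ {suc n} (suc j) x y = ≈-trans (+-congˡ (sum-≟ j x y))
    (solve 3 (λ m x y → y :+ (x :+ m :* y) := x :+ (# 1 :+ m) :* y) ≈-refl (fromℕ n) x y)

  average : ∀ {n} → Distribution n → (Fin n → ℝ) → ℝ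
  average d f = sum λ i → weight d i * f i

  average-cong : ∀ {n} (d : Distribution n) {f g} → (∀ i → f i ≈ g i) → average d f ≈ average d g
  average-cong d f≈g = sum-cong-≋ λ i → *-congˡ (f≈g i)

  average-mono-≤ : ∀ {n} (d : Distribution n) {f g} → (∀ i → f i ≤ g i) → average d f ≤ average d g
  average-mono-≤ d f≤g = sum-mono-≤ _ _ λ i → *-monoˡ-≤ (nonneg d i) (f≤g i)

  average-const : ∀ {n} (d : Distribution n) x → average d (λ _ → x) ≈ x
  average-const d x = begin-equality
    sum (λ i → weight d i * x)  ≈⟨ *-distribʳ-sum x (weight d) ⟨
    sum (weight d) * x          ≈⟨ *-congʳ (normalised d) ⟩
    1# * x                      ≈⟨ *-identityˡ x ⟩
    x                           ∎

  average-+ : ∀ {n} (d : Distribution n) f g → average d (λ i → f i + g i) ≈ average d f + average d g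
  average-+ d f g = ≈-trans (sum-cong-≋ λ i → distribˡ (weight d i) (f i) (g i)) 
    (∑-distrib-+ (λ i → weight d i * f i) (λ i → weight d i * g i))

  average-* : ∀ {n} (d : Distribution n) x f → average d (λ i → x * f i) ≈ x * average d f
  average-* d x f = ≈-trans
    (sum-cong-≋ λ i → solve 3 (λ w x f → w :* (x :* f) := x :* (w :* f)) ≈-refl (weight d i) x (f i))
    (≈-sym (*-distribˡ-sum x (λ i → weight d i * f i)))

  Answers : ℕ → Set
  Answers K = Fin K → Bool → ℝ

  -- The law of the answers is a parameter, so that one tree can be run against two truths or
  -- against fair coins. The recursion averages from the leaves up, which is the shape of the
  -- inductions below.
  expect : ∀ {K T} → Answers K → Algorithm K T → (Fin (suc K) → ℝ) → ℝ
  expect a (output d)  w = average d w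
  expect a (query d f) w = average d λ i →
    a i true * expect a (f i true) w + a i false * expect a (f i false) w

  answers : ∀ {K} → ℝ → Vec ℝ K → ℝ → Answers K
  answers p Xs X i = answer p X (lookup Xs i)

  module _ {K : ℕ} (a : Answers K) where

    expect-cong : ∀ {T} (μ̂ : Algorithm K T) {v w} → (∀ j → v j ≈ w j) → expect a μ̂ v ≈ expect a μ̂ w
    expect-cong (output d)  v≈w = average-cong d v≈w
    expect-cong (query d f) v≈w = average-cong d λ i →
      +-cong (*-congˡ (expect-cong (f i true) v≈w)) (*-congˡ (expect-cong (f i false) v≈w))

    expect-+ : ∀ {T} (μ̂ : Algorithm K T) v w →
               expect a μ̂ (λ j → v j + w j) ≈ expect a μ̂ v + expect a μ̂ w
    expect-+ (output d)  v w = average-+ d v w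
    expect-+ (query d f) v w = ≈-trans
      (average-cong d λ i → ≈-trans
        (+-cong (*-congˡ (expect-+ (f i true) v w)) (*-congˡ (expect-+ (f i false) v w)))
        (solve 6 (λ s t v₁ w₁ v₂ w₂ →
            s :* (v₁ :+ w₁) :+ t :* (v₂ :+ w₂) := s :* v₁ :+ t :* v₂ :+ (s :* w₁ :+ t :* w₂)) ≈-refl
          (a i true) (a i false) (expect a (f i true) v) (expect a (f i true) w)
          (expect a (f i false) v) (expect a (f i false) w)))
      (average-+ d (λ i → a i true * expect a (f i true) v + a i false * expect a (f i false) v)
                   (λ i → a i true * expect a (f i true) w + a i false * expect a (f i false) w))

    expect-* : ∀ {T} (μ̂ : Algorithm K T) x w → expect a μ̂ (λ j → x * w j) ≈ x * expect a μ̂ w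
    expect-* (output d)  x w = average-* d x w
    expect-* (query d f) x w = ≈-trans
      (average-cong d λ i → ≈-trans
        (+-cong (*-congˡ (expect-* (f i true) x w)) (*-congˡ (expect-* (f i false) x w)))
        (solve 5 (λ s t x w₁ w₂ → s :* (x :* w₁) :+ t :* (x :* w₂) := x :* (s :* w₁ :+ t :* w₂)) ≈-refl
          (a i true) (a i false) x (expect a (f i true) w) (expect a (f i false) w)))
      (average-* d x (λ i → a i true * expect a (f i true) w + a i false * expect a (f i false) w))

    expect-const : (∀ i → a i true + a i false ≈ 1#) →
                   ∀ {T} (μ̂ : Algorithm K T) x → expect a μ̂ (λ _ → x) ≈ x
    expect-const total (output d)  x = average-const d x
    expect-const total (query d f) x = ≈-trans
      (average-cong d λ i → begin-equality
        a i true * expect a (f i true) (λ _ → x) + a i false * expect a (f i false) (λ _ → x)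
          ≈⟨ +-cong (*-congˡ (expect-const total (f i true) x)) (*-congˡ (expect-const total (f i false) x)) ⟩
        a i true * x + a i false * x  ≈⟨ distribʳ x _ _ ⟨
        (a i true + a i false) * x    ≈⟨ *-congʳ (total i) ⟩
        1# * x                        ≈⟨ *-identityˡ x ⟩
        x                             ∎)
      (average-const d x)

    expect-sum : ∀ {T n} (μ̂ : Algorithm K T) (w : Fin n → Fin (suc K) → ℝ) →
                 expect a μ̂ (λ j → sum λ k → w k j) ≈ sum λ k → expect a μ̂ (w k)
    expect-sum {n = zero}  μ̂ w = begin-equality
      expect a μ̂ (λ _ → 0#)       ≈⟨ expect-cong μ̂ (λ _ → zeroˡ 0#) ⟨
      expect a μ̂ (λ _ → 0# * 0#)  ≈⟨ expect-* μ̂ 0# (λ _ → 0#) ⟩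
      0# * expect a μ̂ (λ _ → 0#)  ≈⟨ zeroˡ _ ⟩
      0#                          ∎
    expect-sum {n = suc n} μ̂ w = ≈-trans (expect-+ μ̂ (w zero) (λ j → sum λ k → w (suc k) j)) 
      (+-congˡ (expect-sum μ̂ (λ k → w (suc k))))

  outputLaw-expect : ∀ {K T} p (Xs : Vec ℝ K) X (μ̂ : Algorithm K T) w →
                     sum (λ j → outputLaw p Xs X μ̂ j * w j) ≈ expect (answers p Xs X) μ̂ w
  outputLaw-expect p Xs X (output d)  w = ≈-refl
  outputLaw-expect {K} p Xs X (query d f) w = begin-equality
    sum (λ j → average d (λ i → inner i j) * w j)
      ≈⟨ sum-cong-≋ (λ j → *-distribʳ-sum (w j) (λ i → weight d i * inner i j)) ⟩
    sum (λ j → sum (λ i → weight d i * inner i j * w j))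
      ≈⟨ ∑-comm (λ j i → weight d i * inner i j * w j) ⟩
    sum (λ i → sum (λ j → weight d i * inner i j * w j))
      ≈⟨ sum-cong-≋ (λ i → sum-cong-≋ (λ j → *-assoc (weight d i) (inner i j) (w j))) ⟩
    sum (λ i → sum (λ j → weight d i * (inner i j * w j)))
      ≈⟨ sum-cong-≋ (λ i → *-distribˡ-sum (weight d i) (λ j → inner i j * w j)) ⟨
    average d (λ i → sum (λ j → inner i j * w j))
      ≈⟨ average-cong d inner-expect ⟩
    expect a (query d f) w ∎
    where
    a = answers p Xs X
    law : Fin K → Bool → Fin (suc K) → ℝ
    law i b = outputLaw p Xs X (f i b)
    inner : Fin K → Fin (suc K) → ℝ
    inner i j = a i true * law i true j + a i false * law i false j

    inner-expect : ∀ i → sum (λ j → inner i j * w j) ≈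
                   a i true * expect a (f i true) w + a i false * expect a (f i false) w
    inner-expect i = begin-equality
      sum (λ j → inner i j * w j)
        ≈⟨ sum-cong-≋ (λ j → solve 5 (λ s t u v w →
             (s :* u :+ t :* v) :* w := s :* (u :* w) :+ t :* (v :* w)) ≈-refl
             (a i true) (a i false) (law i true j) (law i false j) (w j)) ⟩
      sum (λ j → a i true * (law i true j * w j) + a i false * (law i false j * w j))
        ≈⟨ ∑-distrib-+ (λ j → a i true * (law i true j * w j)) (λ j → a i false * (law i false j * w j)) ⟩
      sum (λ j → a i true * (law i true j * w j)) + sum (λ j → a i false * (law i false j * w j))
        ≈⟨ +-cong (*-distribˡ-sum (a i true) (λ j → law i true j * w j))
                  (*-distribˡ-sum (a i false) (λ j → law i false j * w j)) ⟨
      a i true * sum (λ j → law i true j * w j) + a i false * sum (λ j → law i false j * w j)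
        ≈⟨ +-cong (*-congˡ (outputLaw-expect p Xs X (f i true) w))
                  (*-congˡ (outputLaw-expect p Xs X (f i false) w)) ⟩
      a i true * expect a (f i true) w + a i false * expect a (f i false) w ∎

  miss : ∀ {n} → Fin n → Fin n → ℝ
  miss k j = if does (j Fin.≟ k) then 0# else 1#

  -- By tilt, logRatio is log (a′ / a), so that bound reads KL(a i ‖ a′ i) ≤ κ.
  record Divergence≤ {K : ℕ} (a a′ : Answers K) (κ : ℝ) : Set where
    field
      0≤a       : ∀ i b → 0# ≤ a i b
      total     : ∀ i → a i true + a i false ≈ 1#
      total′    : ∀ i → a′ i true + a′ i false ≈ 1#
      logRatio  : Fin K → Bool → ℝ
      tilt      : ∀ i b → a i b * exp (logRatio i b) ≈ a′ i b
      bound     : ∀ i → - κ ≤ a i true * logRatio i true + a i false * logRatio i false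

  module _ {K : ℕ} {a a′ : Answers K} {κ : ℝ} (div : Divergence≤ a a′ κ) where
    open Divergence≤ div

    -- The likelihood ratio of the first answer is absorbed into v.
    donsker-varadhan : ∀ {T} (μ̂ : Algorithm K T) v →
      expect a μ̂ v ≤ fromℕ T * κ + (expect a′ μ̂ (λ j → exp (v j)) - 1#)
    donsker-varadhan (output d) v = begin
      -- With no queries left only v ≤ exp v - 1 remains, and both of its sides commute with
      -- averaging over the output.
      average d v                          ≤⟨ average-mono-≤ d (λ j → ≤-respˡ
        (solve 1 (λ v → # 1 :+ v :- # 1 := v) ≈-refl (v j)) (+-mono-≤ (1+x≤exp (v j)) ≤-refl)) ⟩
      average d (λ j → exp (v j) - 1#)     ≈⟨ average-+ d (λ j → exp (v j)) (λ _ → - 1#) ⟩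
      average d (λ j → exp (v j)) + average d (λ _ → - 1#) ≈⟨ +-congˡ (average-const d (- 1#)) ⟩
      average d (λ j → exp (v j)) - 1#     ≈⟨ solve 2 (λ k s → s := # 0 :* k :+ s) ≈-refl κ _ ⟩
      0# * κ + (average d (λ j → exp (v j)) - 1#) ∎
    donsker-varadhan {suc T} (query d f) v = begin
      average d (λ i → a i true * E i true + a i false * E i false)
        ≤⟨ average-mono-≤ d step ⟩
      average d (λ i → c + (a′ i true * S i true + a′ i false * S i false))
        ≈⟨ average-+ d (λ _ → c) (λ i → a′ i true * S i true + a′ i false * S i false) ⟩
      average d (λ _ → c) + expect a′ (query d f) (λ j → exp (v j))
        ≈⟨ +-congʳ (average-const d c) ⟩
      c + expect a′ (query d f) (λ j → exp (v j))
        ≈⟨ solve 3 (λ t k s → (t :* k :+ k :- # 1) :+ s := (# 1 :+ t) :* k :+ (s :- # 1)) ≈-refl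
             (fromℕ T) κ (expect a′ (query d f) (λ j → exp (v j))) ⟩
      fromℕ (suc T) * κ + (expect a′ (query d f) (λ j → exp (v j)) - 1#) ∎
      where
      c = fromℕ T * κ + κ - 1#
      E S : Fin K → Bool → ℝ
      E i b = expect a (f i b) v
      S i b = expect a′ (f i b) (λ j → exp (v j))

      branch : ∀ i b → a i b * E i b ≤ a i b * (fromℕ T * κ - 1#) - a i b * logRatio i b + a′ i b * S i b
      branch i b = begin
        a i b * E i b
          ≈⟨ solve 3 (λ a e l → a :* e := a :* (e :+ l) :- a :* l) ≈-refl (a i b) (E i b) ℓ ⟩
        a i b * (E i b + ℓ) - a i b * ℓ
          ≈⟨ +-congʳ (*-congˡ (≈-trans (expect-+ a (f i b) v (λ _ → ℓ))
               (+-congˡ (expect-const a total (f i b) ℓ)))) ⟨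
        a i b * expect a (f i b) (λ j → v j + ℓ) - a i b * ℓ
          ≤⟨ +-mono-≤ (*-monoˡ-≤ (0≤a i b) (donsker-varadhan (f i b) (λ j → v j + ℓ))) ≤-refl ⟩
        a i b * (fromℕ T * κ + (expect a′ (f i b) (λ j → exp (v j + ℓ)) - 1#)) - a i b * ℓ
          ≈⟨ +-congʳ (*-congˡ (+-congˡ (+-congʳ (≈-trans
               (expect-cong a′ (f i b) (λ j → ≈-trans (exp-+ (v j) ℓ) (*-comm _ _)))
               (expect-* a′ (f i b) (exp ℓ) (λ j → exp (v j))))))) ⟩
        a i b * (fromℕ T * κ + (exp ℓ * S i b - 1#)) - a i b * ℓ
          ≈⟨ solve 5 (λ a t e s l → a :* (t :+ (e :* s :- # 1)) :- a :* l
                                 := a :* (t :- # 1) :- a :* l :+ a :* e :* s) ≈-refl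
               (a i b) (fromℕ T * κ) (exp ℓ) (S i b) ℓ ⟩
        a i b * (fromℕ T * κ - 1#) - a i b * ℓ + a i b * exp ℓ * S i b
          ≈⟨ +-congˡ (*-congʳ (tilt i b)) ⟩
        a i b * (fromℕ T * κ - 1#) - a i b * ℓ + a′ i b * S i b ∎
        where ℓ = logRatio i b

      step : ∀ i → a i true * E i true + a i false * E i false ≤
                   c + (a′ i true * S i true + a′ i false * S i false)
      step i = ≤-trans (+-mono-≤ (branch i true) (branch i false))
        (≤-by _ (x≤y⇒0≤y-x (bound i)) (begin-equality
          c + Σ
            ≈⟨ solve 3 (λ t k s → t :+ k :- # 1 :+ s := # 1 :* (t :- # 1) :+ k :+ s) ≈-refl (fromℕ T * κ) κ Σ ⟩
          1# * (fromℕ T * κ - 1#) + κ + Σ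
            ≈⟨ +-congʳ (+-congʳ (*-congʳ (total i))) ⟨
          (a i true + a i false) * (fromℕ T * κ - 1#) + κ + Σ
            ≈⟨ solve 8 (λ s t u k x y p q →
                 (s :+ t) :* u :+ k :+ (p :+ q) :=
                 s :* u :- s :* x :+ p :+ (t :* u :- t :* y :+ q) :+ (s :* x :+ t :* y :- :- k)) ≈-refl
                 (a i true) (a i false) (fromℕ T * κ - 1#) κ (logRatio i true) (logRatio i false)
                 (a′ i true * S i true) (a′ i false * S i false) ⟩
          a i true * (fromℕ T * κ - 1#) - a i true * logRatio i true + a′ i true * S i true
            + (a i false * (fromℕ T * κ - 1#) - a i false * logRatio i false + a′ i false * S i false)
            + (a i true * logRatio i true + a i false * logRatio i false - - κ) ∎))
        where Σ = a′ i true * S i true + a′ i false * S i false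

    -- With ρ² = exp x and σ² = exp (− D), both bounds of min 1 (exp x) are
    -- completed squares, by 1 + (x + D)/2 ≤ ρ/σ.
    module _ (x D : ℝ) where
      private
        ρ σ : ℝ
        ρ = exp (x * ½)
        σ = exp (- (D * ½))

      exp-x : exp x ≈ ρ * ρ
      exp-x = ≈-trans (exp-cong (≈-sym (halves x))) (exp-+ _ _)

      exp-D : exp (- D) ≈ σ * σ
      exp-D = ≈-trans (exp-cong (≈-trans (-‿cong (≈-sym (halves D)))
        (solve 1 (λ d → :- (d :+ d) := :- d :+ :- d) ≈-refl (D * ½)))) (exp-+ _ _)

      -- The left side is tuned to its mean under `a`. If exp x is the likelihood ratio, with mean
      -- 1, and x has mean at least - D, then the mean is at least exp (- D) · (3 + 0 - 1) = 2 exp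
      -- (- D). Since it lies below 4 min 1 (exp x) pointwise, the two errors sum to at least half
      -- of exp (- D).
      tangent : exp (- D) * (fromℕ 3 + fromℕ 2 * (x + D) - exp x) ≤
                fromℕ 4 * (σ * ρ) - σ * σ - σ * σ * (ρ * ρ)
      tangent = begin
        exp (- D) * (fromℕ 3 + fromℕ 2 * (x + D) - exp x)
          ≈⟨ *-congˡ (+-congʳ (+-congˡ (*-congˡ (halves (x + D))))) ⟨
        exp (- D) * (fromℕ 3 + fromℕ 2 * ((x + D) * ½ + (x + D) * ½) - exp x)
          ≈⟨ *-congˡ (solve 2 (λ e y → # 3 :+ # 2 :* (y :+ y) :- e := # 4 :* (# 1 :+ y) :- (# 1 :+ e)) ≈-refl
               (exp x) ((x + D) * ½)) ⟩
        exp (- D) * (fromℕ 4 * (1# + (x + D) * ½) - (1# + exp x))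
          ≤⟨ *-monoˡ-≤ (<⇒≤ (0<exp (- D))) (+-mono-≤ (*-monoˡ-≤ (0≤fromℕ 4) (1+x≤exp ((x + D) * ½))) ≤-refl) ⟩
        exp (- D) * (fromℕ 4 * exp ((x + D) * ½) - (1# + exp x))
          ≈⟨ *-cong exp-D (+-cong ≈-refl (-‿cong (+-congˡ exp-x))) ⟩
        σ * σ * (fromℕ 4 * exp ((x + D) * ½) - (1# + ρ * ρ))
          ≈⟨ solve 3 (λ s t r → s :* s :* (# 4 :* t :- (# 1 :+ r :* r)) :=
                                # 4 :* (s :* (s :* t)) :- s :* s :- s :* s :* (r :* r)) ≈-refl
               σ (exp ((x + D) * ½)) ρ ⟩
        fromℕ 4 * (σ * (σ * exp ((x + D) * ½))) - σ * σ - σ * σ * (ρ * ρ)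
          ≈⟨ +-congʳ (+-congʳ (*-congˡ (*-congˡ (≈-trans (≈-sym (exp-+ _ _))
               (exp-cong (solve 3 (λ x d h → :- (d :* h) :+ (x :+ d) :* h := x :* h) ≈-refl x D ½)))))) ⟩
        fromℕ 4 * (σ * ρ) - σ * σ - σ * σ * (ρ * ρ) ∎

      tangent-≤-1 : exp (- D) * (fromℕ 3 + fromℕ 2 * (x + D) - exp x) ≤ fromℕ 4 * 1#
      tangent-≤-1 = ≤-trans tangent
        (≤-by _ (0≤x+y (0≤x*x (fromℕ 2 - σ * ρ)) (0≤x*x σ))
          (solve 2 (λ s r → # 4 :* # 1 := # 4 :* (s :* r) :- s :* s :- s :* s :* (r :* r)
            :+ ((# 2 :- s :* r) :* (# 2 :- s :* r) :+ s :* s)) ≈-refl σ ρ))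

      tangent-≤-exp : exp (- D) * (fromℕ 3 + fromℕ 2 * (x + D) - exp x) ≤ fromℕ 4 * exp x
      tangent-≤-exp = ≤-trans tangent (≤-respʳ (*-congˡ (≈-sym exp-x))
        (≤-by _ (0≤x+y (0≤x*x (fromℕ 2 * ρ - σ)) (0≤x*x (σ * ρ)))
          (solve 2 (λ s r → # 4 :* (r :* r) := # 4 :* (s :* r) :- s :* s :- s :* s :* (r :* r)
            :+ ((# 2 :* r :- s) :* (# 2 :* r :- s) :+ s :* r :* (s :* r))) ≈-refl σ ρ)))

    -- Bretagnolle–Huber, in a form that is affine in the likelihood ratio
    -- exp x and its logarithm, and hence stable under averaging.
    bretagnolle-huber : ∀ {T} (μ̂ : Algorithm K T) {φ ψ} →
      (∀ j → 0# ≤ φ j) → (∀ j → 0# ≤ ψ j) → (∀ j → 1# ≤ φ j + ψ j) → ∀ x D →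
      exp (- D) * (fromℕ 3 + fromℕ 2 * (x + (D - fromℕ T * κ)) - exp x) ≤
      fromℕ 4 * (expect a μ̂ φ + exp x * expect a′ μ̂ ψ)
    bretagnolle-huber (output d) {φ} {ψ} 0≤φ 0≤ψ 1≤φ+ψ x D = begin
      exp (- D) * (fromℕ 3 + fromℕ 2 * (x + (D - 0# * κ)) - exp x)
        ≈⟨ solve 5 (λ n x D k e → n :* (# 3 :+ # 2 :* (x :+ (D :- # 0 :* k)) :- e) :=
                                  n :* (# 3 :+ # 2 :* (x :+ D) :- e)) ≈-refl (exp (- D)) x D κ (exp x) ⟩
      L
        ≈⟨ average-const d L ⟨
      average d (λ _ → L)
        ≤⟨ average-mono-≤ d (λ j → pointwise j (≤-total 1# (exp x))) ⟩
      average d (λ j → fromℕ 4 * (φ j + exp x * ψ j))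
        ≈⟨ average-* d (fromℕ 4) (λ j → φ j + exp x * ψ j) ⟩
      fromℕ 4 * average d (λ j → φ j + exp x * ψ j)
        ≈⟨ *-congˡ (≈-trans (average-+ d φ (λ j → exp x * ψ j)) (+-congˡ (average-* d (exp x) ψ))) ⟩
      fromℕ 4 * (average d φ + exp x * average d ψ) ∎
      where
      L = exp (- D) * (fromℕ 3 + fromℕ 2 * (x + D) - exp x)

      -- The integrand φ + exp x · ψ is at least min 1 (exp x) · (φ + ψ), hence at least min 1 (exp
      -- x); the case split decides which of the two is the minimum.
      pointwise : ∀ j → 1# ≤ exp x ⊎ exp x ≤ 1# → L ≤ fromℕ 4 * (φ j + exp x * ψ j)
      pointwise j (inj₁ 1≤e) = ≤-trans (tangent-≤-1 x D) (*-monoˡ-≤ (0≤fromℕ 4) (begin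
        1#                   ≤⟨ 1≤φ+ψ j ⟩
        φ j + ψ j            ≈⟨ +-congˡ (*-identityˡ _) ⟨
        φ j + 1# * ψ j       ≤⟨ +-monoʳ-≤ _ (*-monoʳ-≤ (0≤ψ j) 1≤e) ⟩
        φ j + exp x * ψ j    ∎))
      pointwise j (inj₂ e≤1) = ≤-trans (tangent-≤-exp x D) (*-monoˡ-≤ (0≤fromℕ 4) (begin
        exp x                      ≈⟨ *-identityʳ _ ⟨
        exp x * 1#                 ≤⟨ *-monoˡ-≤ (<⇒≤ (0<exp x)) (1≤φ+ψ j) ⟩
        exp x * (φ j + ψ j)        ≈⟨ distribˡ _ _ _ ⟩
        exp x * φ j + exp x * ψ j  ≤⟨ +-mono-≤ (*-monoʳ-≤ (0≤φ j) e≤1) ≤-refl ⟩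
        1# * φ j + exp x * ψ j     ≈⟨ +-congʳ (*-identityˡ _) ⟩
        φ j + exp x * ψ j          ∎))
    -- `x` accumulates the log likelihood ratio of the answers so far. `D` is the whole divergence
    -- budget and stays fixed along the tree, so `D − T κ` is the part already spent.
    bretagnolle-huber {suc T} (query d f) {φ} {ψ} 0≤φ 0≤ψ 1≤φ+ψ x D = begin
      ε * (fromℕ 3 + fromℕ 2 * (x + (D - fromℕ (suc T) * κ)) - exp x)
        ≈⟨ average-const d _ ⟨
      average d (λ _ → ε * (fromℕ 3 + fromℕ 2 * (x + (D - fromℕ (suc T) * κ)) - exp x))
        ≤⟨ average-mono-≤ d step ⟩
      average d (λ i → fromℕ 4 * (Φ i + exp x * Ψ i))
        ≈⟨ average-* d (fromℕ 4) (λ i → Φ i + exp x * Ψ i) ⟩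
      fromℕ 4 * average d (λ i → Φ i + exp x * Ψ i)
        ≈⟨ *-congˡ (≈-trans (average-+ d Φ (λ i → exp x * Ψ i)) (+-congˡ (average-* d (exp x) Ψ))) ⟩
      fromℕ 4 * (average d Φ + exp x * average d Ψ) ∎
      where
      ε = exp (- D)
      F G : Fin K → Bool → ℝ
      F i b = expect a (f i b) φ
      G i b = expect a′ (f i b) ψ
      Φ Ψ : Fin K → ℝ
      Φ i = a i true * F i true + a i false * F i false
      Ψ i = a′ i true * G i true + a′ i false * G i false
      c = fromℕ 3 + fromℕ 2 * (x + (D - fromℕ T * κ))

      branch : ∀ i b → ε * (a i b * c + fromℕ 2 * (a i b * logRatio i b) - exp x * a′ i b) ≤
                       fromℕ 4 * (a i b * F i b + exp x * (a′ i b * G i b))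
      branch i b = begin
        ε * (a i b * c + fromℕ 2 * (a i b * ℓ) - exp x * a′ i b)
          ≈⟨ *-congˡ (+-congˡ (-‿cong (*-congˡ (tilt i b)))) ⟨
        ε * (a i b * c + fromℕ 2 * (a i b * ℓ) - exp x * (a i b * exp ℓ))
          ≈⟨ solve 7 (λ n a x z l e g →
               n :* (a :* (# 3 :+ # 2 :* (x :+ z)) :+ # 2 :* (a :* l) :- e :* (a :* g)) :=
               a :* (n :* (# 3 :+ # 2 :* (x :+ l :+ z) :- e :* g))) ≈-refl
               ε (a i b) x (D - fromℕ T * κ) ℓ (exp x) (exp ℓ) ⟩
        a i b * (ε * (fromℕ 3 + fromℕ 2 * (x + ℓ + (D - fromℕ T * κ)) - exp x * exp ℓ))
          ≈⟨ *-congˡ (*-congˡ (+-congˡ (-‿cong (exp-+ x ℓ)))) ⟨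
        a i b * (ε * (fromℕ 3 + fromℕ 2 * (x + ℓ + (D - fromℕ T * κ)) - exp (x + ℓ)))
          ≤⟨ *-monoˡ-≤ (0≤a i b) (bretagnolle-huber (f i b) 0≤φ 0≤ψ 1≤φ+ψ (x + ℓ) D) ⟩
        a i b * (fromℕ 4 * (F i b + exp (x + ℓ) * G i b))
          ≈⟨ *-congˡ (*-congˡ (+-congˡ (*-congʳ (exp-+ x ℓ)))) ⟩
        a i b * (fromℕ 4 * (F i b + exp x * exp ℓ * G i b))
          ≈⟨ solve 5 (λ a F e g G → a :* (# 4 :* (F :+ e :* g :* G)) :=
                                    # 4 :* (a :* F :+ e :* (a :* g :* G))) ≈-refl
               (a i b) (F i b) (exp x) (exp ℓ) (G i b) ⟩
        fromℕ 4 * (a i b * F i b + exp x * (a i b * exp ℓ * G i b))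
          ≈⟨ *-congˡ (+-congˡ (*-congˡ (*-congʳ (tilt i b)))) ⟩
        fromℕ 4 * (a i b * F i b + exp x * (a′ i b * G i b)) ∎
        where ℓ = logRatio i b

      step : ∀ i → ε * (fromℕ 3 + fromℕ 2 * (x + (D - fromℕ (suc T) * κ)) - exp x) ≤
                   fromℕ 4 * (Φ i + exp x * Ψ i)
      step i = begin
        ε * (fromℕ 3 + fromℕ 2 * (x + (D - fromℕ (suc T) * κ)) - exp x)
          ≈⟨ solve 6 (λ n x D t k e →
               n :* (# 3 :+ # 2 :* (x :+ (D :- (# 1 :+ t) :* k)) :- e) :=
               n :* (# 1 :* (# 3 :+ # 2 :* (x :+ (D :- t :* k))) :+ # 2 :* :- k :- e :* # 1)) ≈-refl
               ε x D (fromℕ T) κ (exp x) ⟩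
        ε * (1# * c + fromℕ 2 * - κ - exp x * 1#)
          ≈⟨ *-congˡ (+-cong (+-congʳ (*-congʳ (total i))) (-‿cong (*-congˡ (total′ i)))) ⟨
        ε * ((a i true + a i false) * c + fromℕ 2 * - κ - exp x * (a′ i true + a′ i false))
          -- One query raises the spent budget by κ, which covers the expected drop of the log ratio
          -- given by `bound`; the ratio itself keeps its mean by `total′`.
          ≤⟨ *-monoˡ-≤ (<⇒≤ (0<exp (- D))) (+-mono-≤ (+-monoʳ-≤ _ (*-monoˡ-≤ (0≤fromℕ 2) (bound i))) ≤-refl) ⟩
        ε * ((a i true + a i false) * c
             + fromℕ 2 * (a i true * logRatio i true + a i false * logRatio i false)
             - exp x * (a′ i true + a′ i false))
          ≈⟨ solve 9 (λ n s t c x y e u v →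
               n :* ((s :+ t) :* c :+ # 2 :* (s :* x :+ t :* y) :- e :* (u :+ v)) :=
               n :* (s :* c :+ # 2 :* (s :* x) :- e :* u) :+ n :* (t :* c :+ # 2 :* (t :* y) :- e :* v)) ≈-refl
               ε (a i true) (a i false) c (logRatio i true) (logRatio i false) (exp x)
               (a′ i true) (a′ i false) ⟩
        ε * (a i true * c + fromℕ 2 * (a i true * logRatio i true) - exp x * a′ i true)
          + ε * (a i false * c + fromℕ 2 * (a i false * logRatio i false) - exp x * a′ i false)
          ≤⟨ +-mono-≤ (branch i true) (branch i false) ⟩
        fromℕ 4 * (a i true * F i true + exp x * (a′ i true * G i true))
          + fromℕ 4 * (a i false * F i false + exp x * (a′ i false * G i false))
          ≈⟨ solve 5 (λ e u v w z → # 4 :* (u :+ e :* v) :+ # 4 :* (w :+ e :* z) :=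
                                    # 4 :* (u :+ w :+ e :* (v :+ z))) ≈-refl (exp x)
               (a i true * F i true) (a′ i true * G i true) (a i false * F i false) (a′ i false * G i false) ⟩
        fromℕ 4 * (Φ i + exp x * Ψ i) ∎

  -- Every output is the answer for some X

  -- `extended` with an arbitrary left end in place of minus infinity. This is the list that the
  -- recursion inside `search` sees after it has passed some entries.
  padded : ∀ {n} → ℝ ± → Vec ℝ n → Vec (ℝ ±) (suc (suc n))
  padded l ys = l ∷ (map [_] ys ∷ʳ ⊤±)

  Between : ∀ {n} → ℝ ± → Vec ℝ n → ℝ → Fin (suc n) → Set
  Between l ys X i = (lookup (padded l ys) (inject₁ i) <± [ X ]) × ([ X ] <± lookup (padded l ys) (suc i))

  head<X : ∀ {n y} {ys : Vec ℝ n} {X} → Linked _<_ (y ∷ ys) → ∀ i →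
           lookup (padded [ y ] ys) (inject₁ i) <± [ X ] → y < X
  head<X                s         zero    [ y<X ]ˢ = y<X
  head<X {ys = z ∷ zs} (y<z ∷ s) (suc i) l<X      = <-trans y<z (head<X s i l<X)

  X<head⇒∉ : ∀ {n y} {ys : Vec ℝ n} {X} → Linked _<_ (y ∷ ys) → X < y → X ∉ (y ∷ ys)
  X<head⇒∉                s         X<y (here X≈y)  = <-irrefl X≈y X<y
  X<head⇒∉ {ys = z ∷ zs} (y<z ∷ s) X<y (there X∈) = X<head⇒∉ s (<-trans X<y y<z) X∈

  Between-unique : ∀ {n l} {ys : Vec ℝ n} {X} → Linked _<_ ys → ∀ i j →
                   Between l ys X i → Between l ys X j → i ≡ j
  Between-unique {ys = []}     s zero    zero    _             _             = ≡.refl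
  Between-unique {ys = y ∷ ys} s zero    zero    _             _             = ≡.refl
  Between-unique {ys = y ∷ ys} s zero    (suc j) (_ , [ X<y ]ˢ) (l<X , _)    =
    contradiction (head<X s j l<X) (<-asym X<y)
  Between-unique {ys = y ∷ ys} s (suc i) zero    (l<X , _)     (_ , [ X<y ]ˢ) =
    contradiction (head<X s i l<X) (<-asym X<y)
  Between-unique {ys = y ∷ ys} s (suc i) (suc j) b             c             =
    ≡.cong suc (Between-unique (Linked.tail s) i j b c)

  Between⇒∉ : ∀ {n l} {ys : Vec ℝ n} {X} → Linked _<_ ys → ∀ i → Between l ys X i → X ∉ ys
  Between⇒∉ {ys = []}     s i       b                ()
  Between⇒∉ {ys = y ∷ ys} s zero    (_ , [ X<y ]ˢ)   X∈         = X<head⇒∉ s X<y X∈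
  Between⇒∉ {ys = y ∷ ys} s (suc i) (l<X , _)        (here X≈y) = <-irrefl (≈-sym X≈y) (head<X s i l<X)
  Between⇒∉ {ys = y ∷ ys} s (suc i) b                (there X∈) = Between⇒∉ (Linked.tail s) i b X∈

  midpoint : ∀ {x y} → x < y → ∃ λ z → x < z × z < y
  midpoint {x} {y} x<y = x + h , x<x+h x 0<h , <-respʳ-≈ x+h+h≈y (x<x+h (x + h) 0<h)
    where
    h = (y - x) * ½
    0<h : 0# < h
    0<h = *-pos (x<y⇒0<y-x x<y) (<-respʳ-≈ (≈-sym (*-identityˡ _)) (x⁻¹>0 (0<fromℕ 2)))
    x+h+h≈y : x + h + h ≈ y
    x+h+h≈y = begin-equality
      x + h + h                 ≈⟨ solve 3 (λ x y t → x :+ (y :- x) :* (# 1 :* t) :+ (y :- x) :* (# 1 :* t) :=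
                                     x :+ (y :- x) :* (# 2 :* t)) ≈-refl x y (fromℕ 2 ⁻¹) ⟩
      x + (y - x) * (fromℕ 2 / fromℕ 2) ≈⟨ +-congˡ (*-congˡ (x*x⁻¹≈1 (0<fromℕ 2))) ⟩
      x + (y - x) * 1#          ≈⟨ solve 2 (λ x y → x :+ (y :- x) :* # 1 := y) ≈-refl x y ⟩
      y                         ∎

  Between-cons-inhabited : ∀ {n y} {ys : Vec ℝ n} → Linked _<_ (y ∷ ys) → ∀ i →
                           ∃ λ X → Between [ y ] ys X i
  Between-cons-inhabited {y = y} {ys = []}     s         zero    =
    y + 1# , [ x<x+h y 0<1 ]ˢ , [ _ ]<⊤±
  Between-cons-inhabited {ys = z ∷ zs} (y<z ∷ s) zero    =
    let X , y<X , X<z = midpoint y<z in X , [ y<X ]ˢ , [ X<z ]ˢ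
  Between-cons-inhabited {ys = z ∷ zs} (y<z ∷ s) (suc i) = Between-cons-inhabited s i

  Between-inhabited : ∀ {n} {ys : Vec ℝ n} → Linked _<_ ys → ∀ i → ∃ λ X → Between ⊥± ys X i
  Between-inhabited {ys = []}     s zero    = 0# , ⊥±<[ 0# ] , [ 0# ]<⊤±
  Between-inhabited {ys = y ∷ ys} s zero    = y - 1# , ⊥±<[ _ ] , [ x-h<x y 0<1 ]ˢ
  Between-inhabited {ys = y ∷ ys} s (suc i) = Between-cons-inhabited s i

  -- Supplies all K + 1 hypotheses for Fano. Uniqueness of the gap containing X identifies whatever
  -- `search` returns with `k`.
  SEARCH-surjective : ∀ {K} {Xs : Vec ℝ K} → Linked _<_ Xs → ∀ k →
                      ∃ λ X → ∃ λ (X∉Xs : X ∉ Xs) → SEARCH Xs X X∉Xs ≡ k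
  SEARCH-surjective {Xs = Xs} s k =
    let X , between = Between-inhabited s k
        X∉Xs = Between⇒∉ s k between
    in  X , X∉Xs , Between-unique s _ k (proj₂ (search Xs X X∉Xs)) between

  -- Noisy comparisons

  /-≤ : ∀ {x y z} → 0# < y → x ≤ z * y → x / y ≤ z
  /-≤ {x} {y} {z} 0<y x≤zy = *-cancelˡ-≤ 0<y (begin
    y * (x / y)  ≈⟨ *-comm y _ ⟩
    x / y * y    ≈⟨ x/y*y≈x x 0<y ⟩
    x            ≤⟨ x≤zy ⟩
    z * y        ≈⟨ *-comm z y ⟩
    y * z        ∎)

  -- Reads off positivity of the divergences, used as denominators, from a positive lower bound on
  -- their multiples.
  0<factor : ∀ {x y} → 0# ≤ x → 0# < x * y → 0# < y
  0<factor {x} {y} 0≤x 0<xy with 0# <? y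
  ... | yes 0<y = 0<y
  ... | no  0≮y = contradiction (≤-respʳ (zeroʳ x) (*-monoˡ-≤ 0≤x (≮⇒≥ 0≮y))) (<⇒≱ 0<xy)

  0<2 : 0# < fromℕ 2
  0<2 = 0<fromℕ 2

  0<log2 : 0# < log (fromℕ 2)
  0<log2 = 0<log (<-respʳ-≈ (+-congˡ (≈-sym (+-identityʳ 1#))) (x<x+h 1# 0<1))

  log2≤1 : log (fromℕ 2) ≤ 1#
  log2≤1 = ≤-respʳ (solve 0 (# 2 :- # 1 := # 1) ≈-refl) (log≤x-1 0<2)

  log-½ : log ½ ≈ - log (fromℕ 2)
  log-½ = ≈-trans (log-/ 0<1 0<2) (≈-trans (+-congʳ log-1) (+-identityˡ _))

  0<½ : 0# < ½
  0<½ = *-pos 0<1 (x⁻¹>0 0<2)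

  1-½≈½ : 1# - ½ ≈ ½
  1-½≈½ = begin-equality
    1# - ½            ≈⟨ +-congʳ (x*x⁻¹≈1 0<2) ⟨
    fromℕ 2 / fromℕ 2 - ½ ≈⟨ solve 1 (λ h → # 2 :* h :- # 1 :* h := # 1 :* h) ≈-refl (fromℕ 2 ⁻¹) ⟩
    ½                 ∎

  -- The tangent to the logarithm at ½, the parameter of the fair coin.
  log+log2≤ : ∀ {x} → 0# < x → log x + log (fromℕ 2) ≤ fromℕ 2 * x - 1#
  log+log2≤ {x} 0<x = begin
    log x + log (fromℕ 2)   ≈⟨ log-* 0<x 0<2 ⟨
    log (x * fromℕ 2)       ≤⟨ log≤x-1 (*-pos 0<x 0<2) ⟩
    x * fromℕ 2 - 1#        ≈⟨ +-congʳ (*-comm _ _) ⟩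
    fromℕ 2 * x - 1#        ∎

  bernoulli-total : ∀ q → bernoulli q true + bernoulli q false ≈ 1#
  bernoulli-total q = solve 1 (λ q → q :+ (# 1 :- q) := # 1) ≈-refl q

  -- Minus the divergence of Bernoulli(q) from Bernoulli(r). The sign is that of the field `bound`,
  -- where the mean log ratio is bounded from below.
  negKL : ℝ → ℝ → ℝ
  negKL q r = q * (log r - log q) + (1# - q) * (log (1# - r) - log (1# - q))

  InUnit : ℝ → Set
  InUnit q = 0# < q × q < 1#

  0<bernoulli : ∀ {q} → InUnit q → ∀ b → 0# < bernoulli q b
  0<bernoulli (0<q , q<1) true  = 0<q
  0<bernoulli (0<q , q<1) false = x<y⇒0<y-x q<1

  bernoulli-divergence : ∀ {K} (q r : Fin K → ℝ) → (∀ i → InUnit (q i)) → (∀ i → InUnit (r i)) →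
    ∀ κ → (∀ i → - κ ≤ negKL (q i) (r i)) →
    Divergence≤ (λ i → bernoulli (q i)) (λ i → bernoulli (r i)) κ
  bernoulli-divergence q r q∈ r∈ κ bound = record
    { 0≤a      = λ i b → <⇒≤ (0<bernoulli (q∈ i) b)
    ; total    = λ i → bernoulli-total (q i)
    ; total′   = λ i → bernoulli-total (r i)
    ; logRatio = λ i b → log (bernoulli (r i) b) - log (bernoulli (q i) b)
    ; tilt     = λ i b → tilt (0<bernoulli (q∈ i) b) (0<bernoulli (r∈ i) b)
    ; bound    = bound }
    where
    tilt : ∀ {x y} → 0# < x → 0# < y → x * exp (log y - log x) ≈ y
    tilt {x} {y} 0<x 0<y = begin-equality
      x * exp (log y - log x)   ≈⟨ *-congˡ (exp-cong (log-/ 0<y 0<x)) ⟨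
      x * exp (log (y / x))     ≈⟨ *-congˡ (exp-log (*-pos 0<y (x⁻¹>0 0<x))) ⟩
      x * (y / x)               ≈⟨ *-comm _ _ ⟩
      y / x * x                 ≈⟨ x/y*y≈x y 0<x ⟩
      y                         ∎

  0≤miss : ∀ {n} (k j : Fin n) → 0# ≤ miss k j
  0≤miss k j with does (j Fin.≟ k)
  ... | true  = ≤-refl
  ... | false = <⇒≤ 0<1

  1≤miss+miss : ∀ {n} {k l : Fin n} → k ≢ l → ∀ j → 1# ≤ miss k j + miss l j
  1≤miss+miss {k = k} {l} k≢l j with j Fin.≟ k | j Fin.≟ l
  ... | yes j≡k | yes j≡l = contradiction (≡.trans (≡.sym j≡k) j≡l) k≢l
  ... | yes _   | no  _   = ≤-reflexive (≈-sym (+-identityˡ 1#))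
  ... | no  _   | yes _   = ≤-reflexive (≈-sym (+-identityʳ 1#))
  ... | no  _   | no  _   = ≤-by 1# (<⇒≤ 0<1) ≈-refl

  -- Divergences and error bounds for a fixed search problem

  module _ (P : SearchProblem) where
    open SearchProblem P

    l₂ Ξ D κ lₚ l₁₋ₚ : ℝ
    l₂   = log (fromℕ 2)
    Ξ    = 1# - H p
    D    = D-KL[ p ‖1-]
    κ    = l₂ * Ξ
    lₚ   = log p
    l₁₋ₚ = log (1# - p)

    0<1-p : 0# < 1# - p
    0<1-p = x<y⇒0<y-x (p<1 P)

    0≤1-2p : 0# ≤ 1# - fromℕ 2 * p
    0≤1-2p = x≤y⇒0≤y-x (begin
      fromℕ 2 * p   ≤⟨ *-monoˡ-≤ (<⇒≤ 0<2) (<⇒≤ p<½) ⟩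
      fromℕ 2 * ½   ≈⟨ 2*½≈1 ⟩
      1#            ∎)

    D≈ : D ≈ (1# - fromℕ 2 * p) * (l₁₋ₚ - lₚ)
    D≈ = *-congˡ (log-/ 0<1-p 0<p)

    0≤D : 0# ≤ D
    0≤D = ≤-respʳ (≈-sym D≈) (0≤x*y 0≤1-2p (x≤y⇒0≤y-x (log-mono-≤ 0<p
      (≤-by _ 0≤1-2p (solve 1 (λ p → # 1 :- p := p :+ (# 1 :- # 2 :* p)) ≈-refl p)))))

    κ≈ : κ ≈ l₂ + p * lₚ + (1# - p) * l₁₋ₚ
    κ≈ = begin-equality
      l₂ * (1# - (- (p * (lₚ / l₂)) - (1# - p) * (l₁₋ₚ / l₂)))
        ≈⟨ solve 5 (λ l v p x y →
             l :* (# 1 :- (:- (p :* (x :* v)) :- (# 1 :- p) :* (y :* v))) :=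
             l :+ (p :* x :+ (# 1 :- p) :* y) :* (l :* v)) ≈-refl l₂ (l₂ ⁻¹) p lₚ l₁₋ₚ ⟩
      l₂ + (p * lₚ + (1# - p) * l₁₋ₚ) * (l₂ / l₂)
        ≈⟨ +-congˡ (*-congˡ (x*x⁻¹≈1 0<log2)) ⟩
      l₂ + (p * lₚ + (1# - p) * l₁₋ₚ) * 1#
        ≈⟨ solve 3 (λ l x y → l :+ (x :+ y) :* # 1 := l :+ x :+ y) ≈-refl l₂ (p * lₚ) ((1# - p) * l₁₋ₚ) ⟩
      l₂ + p * lₚ + (1# - p) * l₁₋ₚ ∎

    -- The difference is the cross entropy − p log (1 − p) − (1 − p) log p, minus log 2.
    κ≤D : κ ≤ D
    κ≤D = 0≤x-y⇒y≤x (begin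
      0#
        -- The tangent bounds at 1 - p and p, weighted by p and 1 - p, have constant part - (1 -
        -- 2p)²; adding the square cancels it.
        ≤⟨ 0≤x+y (0≤x+y (0≤x*y (<⇒≤ 0<p) (x≤y⇒0≤y-x (log+log2≤ 0<1-p)))
                        (0≤x*y (<⇒≤ 0<1-p) (x≤y⇒0≤y-x (log+log2≤ 0<p))))
                 (0≤x*y 0≤1-2p 0≤1-2p) ⟩
      p * (fromℕ 2 * (1# - p) - 1# - (l₁₋ₚ + l₂)) + (1# - p) * (fromℕ 2 * p - 1# - (lₚ + l₂))
        + (1# - fromℕ 2 * p) * (1# - fromℕ 2 * p)
        ≈⟨ solve 4 (λ p x y l →
             p :* (# 2 :* (# 1 :- p) :- # 1 :- (y :+ l)) :+ (# 1 :- p) :* (# 2 :* p :- # 1 :- (x :+ l))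
               :+ (# 1 :- # 2 :* p) :* (# 1 :- # 2 :* p) :=
             (# 1 :- # 2 :* p) :* (y :- x) :- (l :+ p :* x :+ (# 1 :- p) :* y)) ≈-refl p lₚ l₁₋ₚ l₂ ⟩
      (1# - fromℕ 2 * p) * (l₁₋ₚ - lₚ) - (l₂ + p * lₚ + (1# - p) * l₁₋ₚ)
        ≈⟨ +-cong D≈ (-‿cong κ≈) ⟨
      D - κ ∎)

    side : Bool → ℝ
    side b = if b then 1# - p else p

    side∈ : ∀ b → InUnit (side b)
    side∈ true  = 0<1-p , x-h<x 1# 0<p
    side∈ false = 0<p , p<1 P

    ½∈ : InUnit ½
    ½∈ = 0<½ , ½<1

    log-1-[1-p] : log (1# - (1# - p)) ≈ lₚ
    log-1-[1-p] = log-cong (0<bernoulli (side∈ true) false) (1-[1-p]≈p P)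

    -- Answers on the same side of the queried point have equal laws and divergence 0. On opposite
    -- sides the divergence is exactly D, which is symmetric under exchanging p and 1 - p.
    negKL-side : ∀ b c → - D ≤ negKL (side b) (side c)
    negKL-side true  true  = ≤-respʳ (solve 3 (λ q x y → # 0 := q :* (x :- x) :+ (# 1 :- q) :* (y :- y)) ≈-refl
      (1# - p) (log (1# - p)) (log (1# - (1# - p)))) (≤-by D 0≤D (≈-sym (-‿inverseˡ D)))
    negKL-side false false = ≤-respʳ (solve 3 (λ q x y → # 0 := q :* (x :- x) :+ (# 1 :- q) :* (y :- y)) ≈-refl
      p lₚ (log (1# - p))) (≤-by D 0≤D (≈-sym (-‿inverseˡ D)))
    negKL-side false true  = ≤-reflexive (begin-equality
      - D
        ≈⟨ -‿cong D≈ ⟩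
      - ((1# - fromℕ 2 * p) * (l₁₋ₚ - lₚ))
        ≈⟨ solve 3 (λ p x y → :- ((# 1 :- # 2 :* p) :* (y :- x)) := p :* (y :- x) :+ (# 1 :- p) :* (x :- y)) ≈-refl p lₚ l₁₋ₚ ⟩
      p * (l₁₋ₚ - lₚ) + (1# - p) * (lₚ - l₁₋ₚ)
        ≈⟨ +-congˡ (*-congˡ (+-congʳ log-1-[1-p])) ⟨
      p * (l₁₋ₚ - lₚ) + (1# - p) * (log (1# - (1# - p)) - l₁₋ₚ) ∎)
    negKL-side true  false = ≤-reflexive (begin-equality
      - D
        ≈⟨ -‿cong D≈ ⟩
      - ((1# - fromℕ 2 * p) * (l₁₋ₚ - lₚ))
        ≈⟨ solve 3 (λ p x y → :- ((# 1 :- # 2 :* p) :* (y :- x)) :=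
             (# 1 :- p) :* (x :- y) :+ (# 1 :- (# 1 :- p)) :* (y :- x)) ≈-refl p lₚ l₁₋ₚ ⟩
      (1# - p) * (lₚ - l₁₋ₚ) + (1# - (1# - p)) * (l₁₋ₚ - lₚ)
        ≈⟨ +-congˡ (*-congˡ (+-congˡ (-‿cong log-1-[1-p]))) ⟨
      (1# - p) * (lₚ - l₁₋ₚ) + (1# - (1# - p)) * (l₁₋ₚ - log (1# - (1# - p))) ∎)

    log-1-½ : log (1# - ½) ≈ - l₂
    log-1-½ = ≈-trans (log-cong (x<y⇒0<y-x ½<1) 1-½≈½) log-½

    negKL-½ : ∀ b → - κ ≤ negKL (side b) ½
    negKL-½ false = ≤-reflexive (begin-equality
      - κ                                      ≈⟨ -‿cong κ≈ ⟩
      - (l₂ + p * lₚ + (1# - p) * l₁₋ₚ)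
        ≈⟨ solve 4 (λ p x y l → :- (l :+ p :* x :+ (# 1 :- p) :* y) :=
             p :* (:- l :- x) :+ (# 1 :- p) :* (:- l :- y)) ≈-refl p lₚ l₁₋ₚ l₂ ⟩
      p * (- l₂ - lₚ) + (1# - p) * (- l₂ - l₁₋ₚ)
        ≈⟨ +-cong (*-congˡ (+-congʳ log-½)) (*-congˡ (+-congʳ log-1-½)) ⟨
      p * (log ½ - lₚ) + (1# - p) * (log (1# - ½) - l₁₋ₚ) ∎)
    negKL-½ true = ≤-reflexive (begin-equality
      - κ                                      ≈⟨ -‿cong κ≈ ⟩
      - (l₂ + p * lₚ + (1# - p) * l₁₋ₚ)
        ≈⟨ solve 4 (λ p x y l → :- (l :+ p :* x :+ (# 1 :- p) :* y) :=
             (# 1 :- p) :* (:- l :- y) :+ (# 1 :- (# 1 :- p)) :* (:- l :- x)) ≈-refl p lₚ l₁₋ₚ l₂ ⟩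
      (1# - p) * (- l₂ - l₁₋ₚ) + (1# - (1# - p)) * (- l₂ - lₚ)
        ≈⟨ +-cong (*-congˡ (+-congʳ log-½)) (*-congˡ (+-cong log-1-½ (-‿cong log-1-[1-p]))) ⟨
      (1# - p) * (log ½ - l₁₋ₚ) + (1# - (1# - p)) * (log (1# - ½) - log (1# - (1# - p))) ∎)

    fair : Answers K
    fair _ = bernoulli ½

    fair-divergence : ∀ X → Divergence≤ (answers p Xs X) fair κ
    fair-divergence X = bernoulli-divergence (λ i → side (does (lookup Xs i <? X))) (λ _ → ½)
      (λ i → side∈ _) (λ _ → ½∈) κ (λ i → negKL-½ _)

    pair-divergence : ∀ X Y → Divergence≤ (answers p Xs X) (answers p Xs Y) D
    pair-divergence X Y = bernoulli-divergence
      (λ i → side (does (lookup Xs i <? X))) (λ i → side (does (lookup Xs i <? Y)))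
      (λ i → side∈ _) (λ i → side∈ _) D (λ i → negKL-side _ _)

    ℙ-expect : ∀ {T} (μ̂ : Alg P T) k X → ℙ[_≢_∣_] P μ̂ k X ≈ expect (answers p Xs X) μ̂ (miss k)
    ℙ-expect μ̂ k X = ≈-trans (sum-cong-≋ term) (outputLaw-expect p Xs X μ̂ (miss k))
      where
      term : ∀ j → (if does (j Fin.≟ k) then 0# else outputLaw p Xs X μ̂ j) ≈ outputLaw p Xs X μ̂ j * miss k j
      term j with does (j Fin.≟ k)
      ... | true  = ≈-sym (zeroʳ _)
      ... | false = ≈-sym (*-identityʳ _)

    hypothesis : Fin (suc K) → ℝ
    hypothesis k = proj₁ (SEARCH-surjective sorted k)

    expect-miss≤worstError : ∀ {T} (μ̂ : Alg P T) k →
      expect (answers p Xs (hypothesis k)) μ̂ (miss k) ≤ worstError P μ̂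
    expect-miss≤worstError μ̂ k =
      ≡.subst (λ j → expect (answers p Xs X) μ̂ (miss j) ≤ worstError P μ̂) SEARCH≡k
        (proj₁ (proj₂ (worstError-spec P μ̂)) (X , X∉Xs , ≈-sym (ℙ-expect μ̂ (SEARCH Xs X X∉Xs) X)))
      where
      X        = hypothesis k
      X∉Xs     = proj₁ (proj₂ (SEARCH-surjective sorted k))
      SEARCH≡k = proj₂ (proj₂ (SEARCH-surjective sorted k))

    k : ℝ
    k = fromℕ K
    N : ℝ
    N = fromℕ (suc K)

    0<N : 0# < N
    0<N = 0<fromℕ (suc K)

    0<k : 0# < k
    0<k = <-≤-trans 0<2 (fromℕ-mono-≤ 2≤K)

    -- Here A = exp α. The answer laws of the hypotheses differ, but all are compared with the same
    -- law `fair`. After `donsker-varadhan` the N right-hand expectations can therefore be added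
    -- under one expectation, where the weights have the same total N at every output.
    fano : ∀ {T} (μ̂ : Alg P T) {α} → 0# ≤ α →
           α * (1# - worstError P μ̂) ≤ fromℕ T * κ + log ((exp α + k) / N)
    fano {T} μ̂ {α} 0≤α = *-cancelˡ-≤ 0<N (begin
      N * (α * (1# - e))
        ≈⟨ solve 4 (λ n a e l → n :* (a :* (# 1 :- e)) := n :* (a :* (# 1 :- e) :- l) :+ n :* l) ≈-refl N α e (log c) ⟩
      N * (α * (1# - e) - log c) + N * log c
        ≈⟨ +-congʳ (sum-const (suc K) _) ⟨
      sum {suc K} (λ _ → α * (1# - e) - log c) + N * log c
        ≤⟨ +-mono-≤ (sum-mono-≤ _ _ single) ≤-refl ⟩
      sum {suc K} (λ h → t + expect fair μ̂ (λ j → exp (v h j))) + N * log c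
        ≈⟨ +-congʳ (∑-distrib-+ {suc K} (λ _ → t) (λ h → expect fair μ̂ (λ j → exp (v h j)))) ⟩
      sum {suc K} (λ _ → t) + sum (λ h → expect fair μ̂ (λ j → exp (v h j))) + N * log c
        ≈⟨ +-congʳ (+-cong (sum-const (suc K) t) (≈-sym (expect-sum fair μ̂ (λ h j → exp (v h j))))) ⟩
      N * t + expect fair μ̂ (λ j → sum λ h → exp (v h j)) + N * log c
        ≈⟨ +-congʳ (+-congˡ (expect-cong fair μ̂ sum-weights)) ⟩
      N * t + expect fair μ̂ (λ _ → N) + N * log c
        ≈⟨ +-congʳ (+-congˡ (expect-const fair (λ _ → bernoulli-total ½) μ̂ N)) ⟩
      N * t + N + N * log c
        ≈⟨ solve 3 (λ n t l → n :* (t :- # 1) :+ n :+ n :* l := n :* (t :+ l)) ≈-refl N (fromℕ T * κ) (log c) ⟩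
      N * (fromℕ T * κ + log c) ∎)
      where
      e = worstError P μ̂
      c = (exp α + k) / N
      t = fromℕ T * κ - 1#
      0<eα+k : 0# < exp α + k
      0<eα+k = <-trans (0<exp α) (x<x+h (exp α) 0<k)
      0<c : 0# < c
      0<c = *-pos 0<eα+k (x⁻¹>0 0<N)
      v : Fin (suc K) → Fin (suc K) → ℝ
      -- The exponential is A / c when the output is h and 1 / c otherwise; c is the value for which
      -- these sum to N over h.
      v h j = (α - log c) + - α * miss h j

      exp-v : ∀ h j → exp (v h j) ≈ (if does (j Fin.≟ h) then exp α else 1#) * c ⁻¹
      exp-v h j = ≈-trans (exp-cong (solve 3 (λ a l m → (a :- l) :+ :- a :* m := (a :+ :- a :* m) :- l) ≈-refl α (log c) (miss h j)))
        (≈-trans (exp-+ _ _) (*-cong hit (≈-trans (exp-cong (≈-sym (log-⁻¹ 0<c))) (exp-log (x⁻¹>0 0<c)))))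
        where
        hit : exp (α + - α * miss h j) ≈ (if does (j Fin.≟ h) then exp α else 1#)
        hit with does (j Fin.≟ h)
        ... | true  = exp-cong (solve 1 (λ a → a :+ :- a :* # 0 := a) ≈-refl α)
        ... | false = ≈-trans (exp-cong (solve 1 (λ a → a :+ :- a :* # 1 := # 0) ≈-refl α)) exp-0

      sum-weights : ∀ j → sum (λ h → exp (v h j)) ≈ N
      sum-weights j = begin-equality
        sum (λ h → exp (v h j))
          ≈⟨ sum-cong-≋ (λ h → exp-v h j) ⟩
        sum (λ h → (if does (j Fin.≟ h) then exp α else 1#) * c ⁻¹)
          ≈⟨ *-distribʳ-sum (c ⁻¹) (λ h → if does (j Fin.≟ h) then exp α else 1#) ⟨
        sum (λ h → if does (j Fin.≟ h) then exp α else 1#) * c ⁻¹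
          ≈⟨ *-congʳ (sum-≟ j (exp α) 1#) ⟩
        (exp α + k * 1#) * c ⁻¹
          ≈⟨ *-congʳ (+-congˡ (*-identityʳ k)) ⟩
        (exp α + k) * c ⁻¹
          ≈⟨ *-congʳ (x/y*y≈x (exp α + k) 0<N) ⟨
        c * N * c ⁻¹
          ≈⟨ solve 3 (λ c n i → c :* n :* i := n :* (c :* i)) ≈-refl c N (c ⁻¹) ⟩
        N * (c * c ⁻¹)
          ≈⟨ *-congˡ (x*x⁻¹≈1 0<c) ⟩
        N * 1#
          ≈⟨ *-identityʳ N ⟩
        N ∎

      single : ∀ h → α * (1# - e) - log c ≤ t + expect fair μ̂ (λ j → exp (v h j))
      single h = begin
        α * (1# - e) - log c
          -- Each single error is at most the worst one, and α ≥ 0 gives this the right sign.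
          ≤⟨ ≤-by _ (0≤x*y 0≤α (x≤y⇒0≤y-x (expect-miss≤worstError μ̂ h)))
               (solve 4 (λ a e l m → (a :- l) :+ :- a :* m := a :* (# 1 :- e) :- l :+ a :* (e :- m)) ≈-refl α e (log c) m) ⟩
        (α - log c) + - α * m
          ≈⟨ +-cong (expect-const a total μ̂ (α - log c)) (expect-* a μ̂ (- α) (miss h)) ⟨
        expect a μ̂ (λ _ → α - log c) + expect a μ̂ (λ j → - α * miss h j)
          ≈⟨ expect-+ a μ̂ (λ _ → α - log c) (λ j → - α * miss h j) ⟨
        expect a μ̂ (v h)
          ≤⟨ donsker-varadhan (fair-divergence (hypothesis h)) μ̂ (v h) ⟩
        fromℕ T * κ + (expect fair μ̂ (λ j → exp (v h j)) - 1#)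
          ≈⟨ solve 2 (λ t s → t :+ (s :- # 1) := t :- # 1 :+ s) ≈-refl (fromℕ T * κ) (expect fair μ̂ (λ j → exp (v h j))) ⟩
        t + expect fair μ̂ (λ j → exp (v h j)) ∎
        where
        a = answers p Xs (hypothesis h)
        open Divergence≤ (fair-divergence (hypothesis h)) using (total)
        m = expect a μ̂ (miss h)

    two-point : ∀ {T} (μ̂ : Alg P T) → exp (- (fromℕ T * D)) ≤ fromℕ 4 * worstError P μ̂
    two-point {T} μ̂ = *-cancelˡ-≤ 0<2 (begin
      fromℕ 2 * ε
        -- Start with likelihood ratio 1 (x = 0) and the budget D set to T times the divergence per
        -- query: nothing has been spent, and 3 - 1 = 2 remains.
        ≈⟨ solve 2 (λ n d → # 2 :* n := n :* (# 3 :+ # 2 :* (# 0 :+ (d :- d)) :- # 1)) ≈-refl ε (fromℕ T * D) ⟩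
      ε * (fromℕ 3 + fromℕ 2 * (0# + (fromℕ T * D - fromℕ T * D)) - 1#)
        ≈⟨ *-congˡ (+-congˡ (-‿cong exp-0)) ⟨
      ε * (fromℕ 3 + fromℕ 2 * (0# + (fromℕ T * D - fromℕ T * D)) - exp 0#)
        ≤⟨ bretagnolle-huber (pair-divergence (hypothesis k₀) (hypothesis k₁)) μ̂
             (0≤miss k₀) (0≤miss k₁) (1≤miss+miss (λ ())) 0# (fromℕ T * D) ⟩
      fromℕ 4 * (expect (answers p Xs (hypothesis k₀)) μ̂ (miss k₀)
                 + exp 0# * expect (answers p Xs (hypothesis k₁)) μ̂ (miss k₁))
        ≤⟨ *-monoˡ-≤ (0≤fromℕ 4) (+-mono-≤ (expect-miss≤worstError μ̂ k₀)
             (*-monoˡ-≤ (<⇒≤ (0<exp 0#)) (expect-miss≤worstError μ̂ k₁))) ⟩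
      fromℕ 4 * (e + exp 0# * e)
        ≈⟨ *-congˡ (+-congˡ (*-congʳ exp-0)) ⟩
      fromℕ 4 * (e + 1# * e)
        ≈⟨ solve 1 (λ e → # 4 :* (e :+ # 1 :* e) := # 2 :* (# 4 :* e)) ≈-refl e ⟩
      fromℕ 2 * (fromℕ 4 * e) ∎)
      where
      e = worstError P μ̂
      ε = exp (- (fromℕ T * D))
      k₀ k₁ : Fin (suc K)
      k₀ = zero
      k₁ = suc (fromℕ< (ℕ.≤-trans (ℕ.s≤s ℕ.z≤n) 2≤K))

  -- From the information bounds to explicit constants

  log4 : log (fromℕ 4) ≈ fromℕ 2 * log (fromℕ 2)
  log4 = begin-equality
    log (fromℕ 4)                       ≈⟨ log-cong (0<fromℕ 4) (solve 0 (# 4 := # 2 :* # 2) ≈-refl) ⟩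
    log (fromℕ 2 * fromℕ 2)             ≈⟨ log-* 0<2 0<2 ⟩
    log (fromℕ 2) + log (fromℕ 2)       ≈⟨ solve 1 (λ l → l :+ l := # 2 :* l) ≈-refl (log (fromℕ 2)) ⟩
    fromℕ 2 * log (fromℕ 2)             ∎

  -log≤ : ∀ {x y} → 0# < x → exp (- y) ≤ fromℕ 4 * x → log (1# / x) ≤ y + fromℕ 2 * log (fromℕ 2)
  -log≤ {x} {y} 0<x e≤4x = begin
    log (1# / x)                     ≈⟨ log-/ 0<1 0<x ⟩
    log 1# - log x                   ≈⟨ +-congʳ log-1 ⟩
    0# - log x                       ≈⟨ solve 2 (λ y l → # 0 :- l := y :+ (:- y) :- l) ≈-refl y (log x) ⟩
    y + - y - log x                  ≤⟨ +-mono-≤ (+-monoʳ-≤ y -y≤) ≤-refl ⟩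
    y + (log (fromℕ 4) + log x) - log x  ≈⟨ solve 3 (λ y l m → y :+ (m :+ l) :- l := y :+ m) ≈-refl y (log x) (log (fromℕ 4)) ⟩
    y + log (fromℕ 4)                ≈⟨ +-congˡ log4 ⟩
    y + fromℕ 2 * log (fromℕ 2)      ∎
    where
    0<4x = *-pos (0<fromℕ 4) 0<x
    -y≤ : - y ≤ log (fromℕ 4) + log x
    -y≤ = ≤-respʳ (log-* (0<fromℕ 4) 0<x) (exp-cancel-≤ (≤-respʳ (≈-sym (exp-log 0<4x)) e≤4x))

  module _ (P : SearchProblem) where
    open SearchProblem P

    private
      -- `m` and `c` are the logarithmic terms of `fano` for A = N² and A = N. The variable x = K -
      -- 2 = N - 3 is nonnegative, so a polynomial inequality holds for all K ≥ 2 once its expansion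
      -- in x has nonnegative coefficients.
      k′ N′ x L l m c : ℝ
      k′ = k P
      N′ = N P
      x  = k′ - fromℕ 2
      L  = log k′
      l  = log N′
      m  = log ((N′ * N′ + k′) / N′)
      c  = log ((N′ + k′) / N′)

    0≤x : 0# ≤ x
    0≤x = x≤y⇒0≤y-x (fromℕ-mono-≤ 2≤K)

    0<N*N : 0# < N′ * N′
    0<N*N = *-pos (0<N P) (0<N P)

    0<N*N+k : 0# < N′ * N′ + k′
    0<N*N+k = <-trans 0<N*N (x<x+h _ (0<k P))

    0<N+k : 0# < N′ + k′
    0<N+k = <-trans (0<N P) (x<x+h _ (0<k P))

    0<L : 0# < L
    0<L = 0<log (<-≤-trans (<-respʳ-≈ (+-congˡ (≈-sym (+-identityʳ 1#))) (x<x+h 1# 0<1)) (fromℕ-mono-≤ 2≤K))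

    L≤l : L ≤ l
    L≤l = log-mono-≤ (0<k P) (≤-by 1# (<⇒≤ 0<1) (+-comm 1# k′))

    l₂≤L : log (fromℕ 2) ≤ L
    l₂≤L = log-mono-≤ 0<2 (fromℕ-mono-≤ 2≤K)

    -- Exponentiated, (N² + K) K ≤ N³, with difference 2K + 1. It says that Fano with A = N² forces
    -- a ≥ log K on an algorithm that never errs.
    m+L≤2l : m + L ≤ l + l
    m+L≤2l = begin
      m + L                              ≈⟨ +-congʳ (log-/ 0<N*N+k (0<N P)) ⟩
      log (N′ * N′ + k′) - l + L         ≈⟨ solve 3 (λ a l L → a :- l :+ L := a :+ L :- l) ≈-refl _ l L ⟩
      log (N′ * N′ + k′) + L - l         ≈⟨ +-congʳ (log-* 0<N*N+k (0<k P)) ⟨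
      log ((N′ * N′ + k′) * k′) - l      ≤⟨ +-mono-≤ (log-mono-≤ (*-pos 0<N*N+k (0<k P))
        (≤-by (fromℕ 2 * k′ + 1#) (0≤x+y (0≤x*y (0≤fromℕ 2) (<⇒≤ (0<k P))) (<⇒≤ 0<1))
          (solve 1 (λ k → let n = # 1 :+ k in n :* n :* n := (n :* n :+ k) :* k :+ (# 2 :* k :+ # 1)) ≈-refl k′)))
        ≤-refl ⟩
      log (N′ * N′ * N′) - l             ≈⟨ +-congʳ (≈-trans (log-* 0<N*N (0<N P)) (+-congʳ (log-* (0<N P) (0<N P)))) ⟩
      l + l + l - l                      ≈⟨ solve 1 (λ l → l :+ l :+ l :- l := l :+ l) ≈-refl l ⟩
      l + l                              ∎

    -- Coefficients: the Taylor expansion of N⁵ − (N² + N − 1)² at N = 3.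
    2m≤3l : m + m ≤ l + l + l
    2m≤3l = begin
      m + m                              ≈⟨ +-cong (log-/ 0<N*N+k (0<N P)) (log-/ 0<N*N+k (0<N P)) ⟩
      log M - l + (log M - l)            ≈⟨ solve 2 (λ a l → a :- l :+ (a :- l) := a :+ a :- (l :+ l)) ≈-refl (log M) l ⟩
      log M + log M - (l + l)            ≈⟨ +-congʳ (log-* 0<N*N+k 0<N*N+k) ⟨
      log (M * M) - (l + l)              ≤⟨ +-mono-≤ (log-mono-≤ (*-pos 0<N*N+k 0<N*N+k) MM≤) ≤-refl ⟩
      log (N′ * N′ * (N′ * N′) * N′) - (l + l)
        ≈⟨ +-congʳ (≈-trans (log-* (*-pos 0<N*N 0<N*N) (0<N P))
             (+-congʳ (≈-trans (log-* 0<N*N 0<N*N) (+-cong logNN logNN)))) ⟩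
      l + l + (l + l) + l - (l + l)      ≈⟨ solve 1 (λ l → l :+ l :+ (l :+ l) :+ l :- (l :+ l) := l :+ l :+ l) ≈-refl l ⟩
      l + l + l                          ∎
      where
      M = N′ * N′ + k′
      logNN = log-* (0<N P) (0<N P)
      MM≤ : M * M ≤ N′ * N′ * (N′ * N′) * N′
      MM≤ = ≤-by (fromℕ 122 + x * (fromℕ 251 + x * (fromℕ 199 + x * (fromℕ 76 + x * (fromℕ 14 + x)))))
        (0≤x+y (0≤fromℕ 122) (0≤x*y 0≤x (0≤x+y (0≤fromℕ 251) (0≤x*y 0≤x (0≤x+y (0≤fromℕ 199)
          (0≤x*y 0≤x (0≤x+y (0≤fromℕ 76) (0≤x*y 0≤x (0≤x+y (0≤fromℕ 14) 0≤x)))))))))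
        (solve 1 (λ k → let n = # 1 :+ k ; x = k :- # 2 in
          n :* n :* (n :* n) :* n := (n :* n :+ k) :* (n :* n :+ k) :+
            (# 122 :+ x :* (# 251 :+ x :* (# 199 :+ x :* (# 76 :+ x :* (# 14 :+ x)))))) ≈-refl k′)

    -- Coefficients: the Taylor expansion of N³ − (2N − 1)² at N = 3.
    2c≤l : c + c ≤ l
    2c≤l = begin
      c + c                              ≈⟨ +-cong (log-/ 0<N+k (0<N P)) (log-/ 0<N+k (0<N P)) ⟩
      log M - l + (log M - l)            ≈⟨ solve 2 (λ a l → a :- l :+ (a :- l) := a :+ a :- (l :+ l)) ≈-refl (log M) l ⟩
      log M + log M - (l + l)            ≈⟨ +-congʳ (log-* 0<N+k 0<N+k) ⟨
      log (M * M) - (l + l)              ≤⟨ +-mono-≤ (log-mono-≤ (*-pos 0<N+k 0<N+k) MM≤) ≤-refl ⟩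
      log (N′ * N′ * N′) - (l + l)
        ≈⟨ +-congʳ (≈-trans (log-* 0<N*N (0<N P)) (+-congʳ (log-* (0<N P) (0<N P)))) ⟩
      l + l + l - (l + l)                ≈⟨ solve 1 (λ l → l :+ l :+ l :- (l :+ l) := l) ≈-refl l ⟩
      l                                  ∎
      where
      M = N′ + k′
      MM≤ : M * M ≤ N′ * N′ * N′
      MM≤ = ≤-by (fromℕ 2 + x * (fromℕ 7 + x * (fromℕ 5 + x)))
        (0≤x+y (0≤fromℕ 2) (0≤x*y 0≤x (0≤x+y (0≤fromℕ 7) (0≤x*y 0≤x (0≤x+y (0≤fromℕ 5) 0≤x)))))
        (solve 1 (λ k → let n = # 1 :+ k ; x = k :- # 2 in
          n :* n :* n := (n :+ k) :* (n :+ k) :+ (# 2 :+ x :* (# 7 :+ x :* (# 5 :+ x)))) ≈-refl k′)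

    module _ {T : ℕ} (μ̂ : Alg P T) where

      private
        e a Tκ : ℝ
        e  = worstError P μ̂
        a  = fromℕ T * Ξ P
        Tκ = fromℕ T * κ P

      0≤e : 0# ≤ e
      0≤e = 0≤worstError P μ̂

      Tκ≈ : Tκ ≈ log (fromℕ 2) * a
      Tκ≈ = solve 3 (λ t l x → t :* (l :* x) := l :* (t :* x)) ≈-refl (fromℕ T) (log (fromℕ 2)) (Ξ P)

      -- Fano at α = 0, where A = 1 and the logarithm vanishes, already yields Tκ ≥ 0. So
      -- nonnegativity of T(1 - H(p)) follows from the existence of an algorithm with T queries.
      0≤a : 0# ≤ a
      0≤a = *-cancelˡ-≤ 0<log2 (begin
        log (fromℕ 2) * 0#   ≈⟨ solve 2 (λ l e → l :* # 0 := # 0 :* (# 1 :- e)) ≈-refl (log (fromℕ 2)) e ⟩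
        0# * (1# - e)        ≤⟨ fano P μ̂ ≤-refl ⟩
        Tκ + log ((exp 0# + k′) / N′) ≈⟨ +-congˡ (log≈ 0<c (≈-trans exp-0 (≈-sym c≈1))) ⟩
        Tκ + 0#              ≈⟨ +-identityʳ _ ⟩
        Tκ                   ≈⟨ Tκ≈ ⟩
        log (fromℕ 2) * a    ∎)
        where
        c≈1 : (exp 0# + k′) / N′ ≈ 1#
        c≈1 = ≈-trans (*-congʳ (+-congʳ exp-0)) (x*x⁻¹≈1 (0<N P))
        0<c = <-respʳ-≈ (≈-sym c≈1) 0<1

      -- The theorem sets an entropy in bits against a natural logarithm, while the information
      -- gained is smaller by the factor log 2 ≤ 1.
      Tκ≤a : Tκ ≤ a
      Tκ≤a = begin
        Tκ                  ≈⟨ Tκ≈ ⟩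
        log (fromℕ 2) * a   ≤⟨ *-monoʳ-≤ 0≤a log2≤1 ⟩
        1# * a              ≈⟨ *-identityˡ a ⟩
        a                   ∎

      0<l : 0# < l
      0<l = <-≤-trans 0<L L≤l

      fano-N² : (l + l) * (1# - e) ≤ a + m
      fano-N² = begin
        (l + l) * (1# - e)                          ≤⟨ fano P μ̂ (0≤x+y (<⇒≤ 0<l) (<⇒≤ 0<l)) ⟩
        Tκ + log ((exp (l + l) + k′) / N′)          ≈⟨ +-congˡ (log-cong
          (*-pos (<-trans (0<exp _) (x<x+h _ (0<k P))) (x⁻¹>0 (0<N P)))
          (*-congʳ (+-congʳ (≈-trans (exp-+ l l) (*-cong (exp-log (0<N P)) (exp-log (0<N P))))))) ⟩
        Tκ + m                                      ≤⟨ +-mono-≤ Tκ≤a ≤-refl ⟩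
        a + m                                       ∎

      fano-N : l * (1# - e) ≤ Tκ + c
      fano-N = begin
        l * (1# - e)                                ≤⟨ fano P μ̂ (<⇒≤ 0<l) ⟩
        Tκ + log ((exp l + k′) / N′)                ≈⟨ +-congˡ (log-cong
          (*-pos (<-trans (0<exp _) (x<x+h _ (0<k P))) (x⁻¹>0 (0<N P)))
          (*-congʳ (+-congʳ (exp-log (0<N P))))) ⟩
        Tκ + c                                      ∎

      -- Fano with A = N² reads e ≥ 1 - (a + m) / 2l. This and the target are affine in a, so for 0
      -- ≤ a ≤ L they need comparing only at a = 0, which is `2m≤3l`, and at a = L, which is
      -- `m+L≤2l`. Beyond L the left side is not positive.
      L-a≤4eL : L - a ≤ fromℕ 4 * e * L
      L-a≤4eL with ≤-total L a
      ... | inj₁ L≤a = begin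
        L - a            ≤⟨ ≤-by (a - L) (x≤y⇒0≤y-x L≤a) (solve 2 (λ L a → # 0 := L :- a :+ (a :- L)) ≈-refl L a) ⟩
        0#               ≤⟨ 0≤x*y (0≤x*y (0≤fromℕ 4) 0≤e) (<⇒≤ 0<L) ⟩
        fromℕ 4 * e * L  ∎
      ... | inj₂ a≤L = *-cancelˡ-≤ 0<l (*-cancelˡ-≤ 0<2
        -- The interpolation with denominators cleared: L - a and a weight the two endpoint
        -- inequalities, and Fano enters with the weight 4L.
        (≤-by _ (0≤x+y (0≤x+y (0≤x*y (0≤x*y (0≤fromℕ 4) (<⇒≤ 0<L)) (x≤y⇒0≤y-x fano-N²))
                               (0≤x*y (0≤x*y (0≤fromℕ 2) (x≤y⇒0≤y-x a≤L)) (x≤y⇒0≤y-x 2m≤3l)))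
                       (0≤x*y (0≤x*y (0≤fromℕ 4) 0≤a) (x≤y⇒0≤y-x m+L≤2l)))
          (solve 5 (λ L a e l m → # 2 :* (l :* (# 4 :* e :* L)) :=
              # 2 :* (l :* (L :- a)) :+
              (# 4 :* L :* (a :+ m :- (l :+ l) :* (# 1 :- e))
               :+ # 2 :* (L :- a) :* (l :+ l :+ l :- (m :+ m))
               :+ # 4 :* a :* (l :+ l :- (m :+ L)))) ≈-refl L a e l m)))

      fano-bound : 1# - fromℕ T * (1# - H p) / log (fromℕ K) ≤ fromℕ 4 * e
      fano-bound = *-cancelˡ-≤ 0<L (begin
        L * (1# - a / L)      ≈⟨ solve 3 (λ L a v → L :* (# 1 :- a :* v) := L :- a :* v :* L) ≈-refl L a (L ⁻¹) ⟩
        L - a / L * L         ≈⟨ +-congˡ (-‿cong (x/y*y≈x a 0<L)) ⟩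
        L - a                 ≤⟨ L-a≤4eL ⟩
        fromℕ 4 * e * L       ≈⟨ *-comm _ L ⟩
        L * (fromℕ 4 * e)     ∎)

      lower-bound : 1# / fromℕ 4 * (exp (- (fromℕ T * D-KL[ p ‖1-])) ⊔
                      (1# - fromℕ T * (1# - H p) / log (fromℕ K))) ≤ e
      lower-bound = begin
        1# / fromℕ 4 * _          ≤⟨ *-monoˡ-≤ 0≤¼ (⊔-lub (two-point P μ̂) fano-bound) ⟩
        1# / fromℕ 4 * (fromℕ 4 * e) ≈⟨ *-assoc _ _ e ⟨
        1# / fromℕ 4 * fromℕ 4 * e ≈⟨ *-congʳ (x/y*y≈x 1# (0<fromℕ 4)) ⟩
        1# * e                    ≈⟨ *-identityˡ e ⟩
        e                         ∎
        where
        0≤¼ = 0≤x*y (<⇒≤ 0<1) (<⇒≤ (x⁻¹>0 (0<fromℕ 4)))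

      module _ {δ : ℝ} (0<δ : 0# < δ) (δ<0·49 : δ < fromℕ 49 / fromℕ 100) (e≤δ : e ≤ δ) where

        e*100≤49 : fromℕ 100 * e ≤ fromℕ 49
        e*100≤49 = begin
          fromℕ 100 * e                       ≤⟨ *-monoˡ-≤ (0≤fromℕ 100) (≤-trans e≤δ (<⇒≤ δ<0·49)) ⟩
          fromℕ 100 * (fromℕ 49 / fromℕ 100)  ≈⟨ *-comm _ _ ⟩
          fromℕ 49 / fromℕ 100 * fromℕ 100    ≈⟨ x/y*y≈x _ (0<fromℕ 100) ⟩
          fromℕ 49                            ∎

        -- Since c ≤ l / 2, Fano with A = N leaves (1/2 - e) l ≤ Tκ, and 1/2 - e is at least 1/100.
        L≤100Tκ : L ≤ fromℕ 100 * Tκ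
        L≤100Tκ = ≤-trans L≤l (≤-by _
          (0≤x+y (0≤x+y (0≤x*y (0≤fromℕ 100) (x≤y⇒0≤y-x fano-N))
                        (0≤x*y (0≤fromℕ 50) (x≤y⇒0≤y-x 2c≤l)))
                 (0≤x*y (<⇒≤ 0<l) (x≤y⇒0≤y-x e*100≤49)))
          (solve 4 (λ l e t c → # 100 :* t := l :+
              (# 100 :* (t :+ c :- l :* (# 1 :- e)) :+ # 50 :* (l :- (c :+ c)) :+ l :* (# 49 :- # 100 :* e)))
            ≈-refl l e Tκ c))

        L≤100TΞ : L ≤ fromℕ 100 * fromℕ T * Ξ P
        L≤100TΞ = begin
          L                          ≤⟨ L≤100Tκ ⟩
          fromℕ 100 * Tκ             ≤⟨ *-monoˡ-≤ (0≤fromℕ 100) Tκ≤a ⟩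
          fromℕ 100 * a              ≈⟨ *-assoc _ _ _ ⟨
          fromℕ 100 * fromℕ T * Ξ P  ∎

        0≤100T : 0# ≤ fromℕ 100 * fromℕ T
        0≤100T = 0≤x*y (0≤fromℕ 100) (0≤fromℕ T)

        l₂≤100TD : log (fromℕ 2) ≤ fromℕ 100 * fromℕ T * D P
        l₂≤100TD = begin
          log (fromℕ 2)              ≤⟨ l₂≤L ⟩
          L                          ≤⟨ L≤100Tκ ⟩
          fromℕ 100 * Tκ             ≈⟨ *-assoc _ _ _ ⟨
          fromℕ 100 * fromℕ T * κ P  ≤⟨ *-monoˡ-≤ 0≤100T (κ≤D P) ⟩
          fromℕ 100 * fromℕ T * D P  ∎

        -- The positive quantity log K lies below a nonnegative multiple of 1 - H(p), which gives
        -- strictness without studying the entropy near ½.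
        0<Ξ : 0# < Ξ P
        0<Ξ = 0<factor 0≤100T (<-≤-trans 0<L L≤100TΞ)

        0<D : 0# < D P
        0<D = 0<factor 0≤100T (<-≤-trans 0<log2 l₂≤100TD)

        -- 201 = 1 + 2 · 100: one TD from the exponent, and log 4 = 2 log 2 absorbed by twice
        -- `l₂≤100TD`.
        log1/δ≤201TD : log (1# / δ) ≤ fromℕ 201 * fromℕ T * D P
        log1/δ≤201TD = begin
          log (1# / δ)
            ≤⟨ -log≤ 0<δ (≤-trans (two-point P μ̂) (*-monoˡ-≤ (0≤fromℕ 4) e≤δ)) ⟩
          fromℕ T * D P + fromℕ 2 * log (fromℕ 2)
            ≤⟨ +-monoʳ-≤ _ (*-monoˡ-≤ (0≤fromℕ 2) l₂≤100TD) ⟩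
          fromℕ T * D P + fromℕ 2 * (fromℕ 100 * fromℕ T * D P)
            ≈⟨ solve 2 (λ t d → t :* d :+ # 2 :* (# 100 :* t :* d) := # 201 :* t :* d) ≈-refl (fromℕ T) (D P) ⟩
          fromℕ 201 * fromℕ T * D P ∎

        query-bound : fromℕ 301 ⁻¹ * (log (fromℕ K) / (1# - H p) + log (1# / δ) / D-KL[ p ‖1-]) ≤ fromℕ T
        query-bound = begin
          -- 301 adds the 100 of the first term to the 201 of the second.
          fromℕ 301 ⁻¹ * (L / Ξ P + log (1# / δ) / D P)
            ≤⟨ *-monoˡ-≤ (<⇒≤ (x⁻¹>0 (0<fromℕ 301))) (+-mono-≤ (/-≤ 0<Ξ L≤100TΞ) (/-≤ 0<D log1/δ≤201TD)) ⟩
          fromℕ 301 ⁻¹ * (fromℕ 100 * fromℕ T + fromℕ 201 * fromℕ T)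
            ≈⟨ solve 2 (λ v t → v :* (# 100 :* t :+ # 201 :* t) := v :* # 301 :* t) ≈-refl (fromℕ 301 ⁻¹) (fromℕ T) ⟩
          fromℕ 301 ⁻¹ * fromℕ 301 * fromℕ T
            ≈⟨ *-congʳ (x⁻¹*x≈1 (0<fromℕ 301)) ⟩
          1# * fromℕ T
            ≈⟨ *-identityˡ _ ⟩
          fromℕ T ∎

mainTheorem5 : (em : ExcludedMiddle 0ℓ) (R : CompleteOrderedField) →
    let open Reals em R
        open SearchProblem
    in
    ((P : SearchProblem) (T : ℕ) →
      1# / fromℕ 4 *
        (exp (- (fromℕ T * D-KL[ p P ‖1-])) ⊔
         (1# - fromℕ T * (1# - H (p P)) / log (fromℕ (K P))))
      ≤ minimaxError P T)
    ×
    (∃ λ (c : ℝ) → 0# < c ×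
      ((P : SearchProblem) (δ : ℝ) → 0# < δ → δ < fromℕ 49 / fromℕ 100 →
       (T : ℕ) (μ̂ : Algorithm (K P) T) → worstError P μ̂ ≤ δ →
       c * (log (fromℕ (K P)) / (1# - H (p P)) + log (1# / δ) / D-KL[ p P ‖1-])
       ≤ fromℕ T))
mainTheorem5 em R =
  -- A bound on every worst error passes to their infimum, the greatest lower bound.
  (λ P T → proj₂ (proj₂ (minimaxError-spec P T))
    λ { (μ̂ , e≈) → ≤-respʳ (≈-sym e≈) (lower-bound P μ̂) }) ,
  fromℕ 301 ⁻¹ , x⁻¹>0 (0<fromℕ 301) ,
  λ P δ 0<δ δ<0·49 T μ̂ e≤δ → query-bound P μ̂ 0<δ δ<0·49 e≤δ
  where
  open Reals em R
  open SearchBounds em R
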